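{- Let $(M_n)_{n\ge1}$, $M_n=(f_n(m,k))_{1\le m,k\le 2n}$, be the Delta sequence, and for $n\ge1$ let $\mathfrak T_{2n+1}$ be the set of strictly ordered binary trees on $2n+1$ vertices. Then for all $n\ge 1$ and all $1\le m,k\le 2n$, $$\#\{t\in\mathfrak T_{2n+1}:\ \mathrm{eoc}(t)=m,\ \mathrm{pom}(t)=k\}=f_n(m,k).$$
   Context: Delta sequence. For $n\ge1$, $M_n=(f_n(m,k))_{1\le m,k\le 2n}$ is a $2n\times 2n$ matrix; by convention $f_n(m,k)=0$ if $(m,k)\notin[1,2n]^2$. Write $f_n(m,\bullet)=\sum_{k=1}^{2n}f_n(m,k)$ and $f_n(\bullet,k)=\sum_{m=1}^{2n}f_n(m,k)$. Let $L_n^{(1)}=\{(m,k):2\le k+1\le m\le 2n-2\}$ and $U_n^{(1)}=\{(m,k):2\le m+1\le k\le 2n-2\}$. The Delta sequence is the unique sequence $(M_n)_{n\ge1}$ of matrices with nonnegative integer entries such that $M_1=\begin{pmatrix}0&0\\1&0\end{pmatrix}$ and, for every $n\ge2$: (a) $f_n(m,m)=0$ for all $m$; (b) $f_n(m+2,k)-2f_n(m+1,k)+f_n(m,k)+2f_{n-1}(m,k)=0$ for $(m,k)\in L_n^{(1)}$; (c) $f_n(m,k+2)-2f_n(m,k+1)+f_n(m,k)+2f_{n-1}(m,k)=0$ for $(m,k)\in U_n^{(1)}$; (d) column $2n$ of $M_n$ is zero, and column $2n-1$ is $(f_{n-1}(1,\bullet),\dots,f_{n-1}(2n-2,\bullet),0,0)$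 read top to bottom; (e) row $2n$ of $M_n$ is $(f_{n-1}(1,\bullet),\dots,f_{n-1}(2n-2,\bullet),0,0)$ read left to right, and row $2n-1$ is $(f_{n-1}(1,\bullet)+f_{n-1}(\bullet,1),\dots,f_{n-1}(2n-2,\bullet)+f_{n-1}(\bullet,2n-2),0,0)$. (These conditions determine the sequence uniquely.) Trees. A strictly ordered binary tree on $N$ vertices is a rooted tree whose vertices are labeled bijectively by $1,\dots,N$, the root being labeled $1$, in which every vertex has either no child (a leaf) or exactly two children (their order is immaterial), and labels increase along every path from the root. Such $N$ is odd; $\mathfrak T_{2n+1}$ denotes the set of these trees on $2n+1$ vertices. For $t\in\mathfrak T_{2n+1}$ ($n\ge1$): the minimal chain starts at the root and repeatedly moves to the child with the smaller label until a leaf is reached; $\mathrm{eoc}(t)$ is the label of that leaf. The vertex $2n+1$ is a leaf, and $\mathrm{pom}(t)$ is the label of its parent. -}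

module Defs where

open import Data.Nat using (ℕ; zero; suc; _+_; _*_; _∸_; _≤_; _<_; _≡ᵇ_)
open import Data.Nat.Properties using (_≟_)
open import Data.Bool using (if_then_else_)
open import Data.Maybe using (Maybe; just; nothing)
open import Data.Fin using (Fin; toℕ)
open import Data.Vec using (Vec; lookup; toList; count)
open import Data.List using (List; []; _∷_; length)
open import Data.List.Relation.Unary.Unique.Propositional using (Unique)
open import Data.List.Membership.Propositional using (_∈_)
open import Data.Product using (_×_; ∃)
open import Data.Sum using (_⊎_)
open import Relation.Binary.PropositionalEquality using (_≡_)

-- Sums and the Delta sequence.
-- A sequence of matrices (M_n) is encoded as f : ℕ → ℕ → ℕ → ℕ with
-- f n m k = f_n(m,k); entries outside [1,2n]² are required to be 0.

sumTo : ℕ → (ℕ → ℕ) → ℕ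
sumTo zero    g = 0
sumTo (suc j) g = sumTo j g + g (suc j)

rowSum : (ℕ → ℕ → ℕ → ℕ) → ℕ → ℕ → ℕ
rowSum f n m = sumTo (2 * n) (λ k → f n m k)

colSum : (ℕ → ℕ → ℕ → ℕ) → ℕ → ℕ → ℕ
colSum f n k = sumTo (2 * n) (λ m → f n m k)

record IsDeltaSequence (f : ℕ → ℕ → ℕ → ℕ) : Set where
  field
    outside : ∀ n m k → 1 ≤ n →
              (m ≡ 0 ⊎ 2 * n < m ⊎ k ≡ 0 ⊎ 2 * n < k) → f n m k ≡ 0
    m1-11 : f 1 1 1 ≡ 0
    m1-12 : f 1 1 2 ≡ 0
    m1-21 : f 1 2 1 ≡ 1
    m1-22 : f 1 2 2 ≡ 0
    diag : ∀ n → 2 ≤ n → ∀ m → f n m m ≡ 0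
    -- (b)  for 2 ≤ k+1 ≤ m ≤ 2n-2 (written without subtraction)
    lower : ∀ n → 2 ≤ n → ∀ m k → 2 ≤ k + 1 → k + 1 ≤ m → m ≤ 2 * n ∸ 2 →
            f n (m + 2) k + f n m k + 2 * f (n ∸ 1) m k ≡ 2 * f n (m + 1) k
    upper : ∀ n → 2 ≤ n → ∀ m k → 2 ≤ m + 1 → m + 1 ≤ k → k ≤ 2 * n ∸ 2 →
            f n m (k + 2) + f n m k + 2 * f (n ∸ 1) m k ≡ 2 * f n m (k + 1)
    col2n : ∀ n → 2 ≤ n → ∀ m → 1 ≤ m → m ≤ 2 * n → f n m (2 * n) ≡ 0
    col2n-1 : ∀ n → 2 ≤ n → ∀ m → 1 ≤ m → m ≤ 2 * n ∸ 2 →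
              f n m (2 * n ∸ 1) ≡ rowSum f (n ∸ 1) m
    col2n-1a : ∀ n → 2 ≤ n → f n (2 * n ∸ 1) (2 * n ∸ 1) ≡ 0
    col2n-1b : ∀ n → 2 ≤ n → f n (2 * n) (2 * n ∸ 1) ≡ 0
    row2n : ∀ n → 2 ≤ n → ∀ k → 1 ≤ k → k ≤ 2 * n ∸ 2 →
            f n (2 * n) k ≡ rowSum f (n ∸ 1) k
    row2na : ∀ n → 2 ≤ n → f n (2 * n) (2 * n ∸ 1) ≡ 0
    row2nb : ∀ n → 2 ≤ n → f n (2 * n) (2 * n) ≡ 0
    row2n-1 : ∀ n → 2 ≤ n → ∀ k → 1 ≤ k → k ≤ 2 * n ∸ 2 →
              f n (2 * n ∸ 1) k ≡ rowSum f (n ∸ 1) k + colSum f (n ∸ 1) k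
    row2n-1a : ∀ n → 2 ≤ n → f n (2 * n ∸ 1) (2 * n ∸ 1) ≡ 0
    row2n-1b : ∀ n → 2 ≤ n → f n (2 * n ∸ 1) (2 * n) ≡ 0

-- Strictly ordered binary trees, encoded by their parent map.
-- A tree on N = suc L vertices labelled 1..N with root 1 is given by
-- p : Vec ℕ L, where lookup p i is the label of the parent of the
-- vertex labelled toℕ i + 2.  (Children are unordered, matching the paper.)

childCount : ∀ {L} → Vec ℕ L → ℕ → ℕ
childCount p v = count (_≟ v) p

record IsSOBT {L : ℕ} (p : Vec ℕ L) : Set where
  field
    -- every non-root vertex w = i+2 has a parent with label in [1, w-1]
    -- (labels increase along every path from the root 1)
    parent-pos : ∀ (i : Fin L) → 1 ≤ lookup p i
    parent-lt  : ∀ (i : Fin L) → lookup p i < toℕ i + 2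
    binary : ∀ v → 1 ≤ v → v ≤ suc L →
             childCount p v ≡ 0 ⊎ childCount p v ≡ 2

nth : List ℕ → ℕ → ℕ
nth []       _       = 0
nth (x ∷ xs) zero    = x
nth (x ∷ xs) (suc i) = nth xs i

parentOf : ∀ {L} → Vec ℕ L → ℕ → ℕ
parentOf p w = nth (toList p) (w ∸ 2)

-- the child of v with smallest label (scanning labels w, w+1, ...)
firstChild : List ℕ → ℕ → ℕ → Maybe ℕ
firstChild []       v w = nothing
firstChild (x ∷ xs) v w = if x ≡ᵇ v then just w else firstChild xs v (suc w)

chain : ℕ → List ℕ → ℕ → ℕ
chain zero       ps v = v
chain (suc fuel) ps v with firstChild ps v 2
... | nothing = v
... | just w  = chain fuel ps w

-- end of the minimal chain (labels strictly increase, so N steps suffice)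
eoc : ∀ {L} → Vec ℕ L → ℕ
eoc {L} p = chain (suc L) (toList p) 1

pom : ∀ {L} → Vec ℕ L → ℕ
pom {L} p = parentOf p (suc L)

Enumerates : (n m k : ℕ) → List (Vec ℕ (2 * n)) → Set
Enumerates n m k ts =
  Unique ts × (∀ p → p ∈ ts → IsSOBT p × eoc p ≡ m × pom p ≡ k)
            × (∀ p → IsSOBT p → eoc p ≡ m → pom p ≡ k → p ∈ ts)

CountIs : (n m k c : ℕ) → Set
CountIs n m k c = ∃ λ ts → Enumerates n m k ts × length ts ≡ c

{-# OPTIONS --safe #-}

-- Read the parent map of a tree from vertex 2 to vertex 2n.  At each moment only the number a of
-- vertices still owed exactly one child, the number b of vertices that may still get two, and the
-- state of the end of the minimal chain matter, so a prefix contributes a monomial x^a y^b and one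
-- more vertex acts by the derivation y δ, where δ = ∂/∂x + x ∂/∂y.  The vertex k = pom acts by x δ
-- instead (one of its children is reserved for 2n+1), and m = eoc by a multiplication.  The equations
-- (b) and (c) say that the double commutator of the step operator with the operator of m, resp. k,
-- is that operator times x² − 2y; this polynomial is killed by the step derivation and has the value −2
-- at the final point x = 0, y = 1.  The boundary conditions (d), (e) follow from the Leibniz rule,
-- and (a)–(e) determine the entries by descending induction along columns and rows.
module Submission where

open import Defs
open import Data.Bool using (true; false; if_then_else_)
open import Data.Empty using (⊥-elim)
open import Data.Fin using (zero; suc; toℕ)
open import Data.Fin.Properties using (toℕ<n)
open import Data.List using (List; []; _∷_; [_]; _++_; length; map; replicate)
open import Data.List.Membership.Propositional using (_∈_)
open import Data.List.Membership.Propositional.Properties using (∈-++⁺ˡ; ∈-++⁺ʳ; ∈-++⁻; ∈-map⁺; ∈-map⁻)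
open import Data.List.Properties using (++-assoc; ++-identityʳ; length-++; length-map; length-replicate)
open import Data.List.Relation.Unary.All as All using (All; []; _∷_)
open import Data.List.Relation.Unary.All.Properties using (∷ʳ⁺)
open import Data.List.Relation.Unary.AllPairs using ([]; _∷_)
open import Data.List.Relation.Unary.Any using (here)
open import Data.List.Relation.Unary.Unique.Propositional using (Unique)
open import Data.List.Relation.Unary.Unique.Propositional.Properties as Unique using ()
open import Data.Maybe using (just; nothing)
open import Data.Nat
open import Data.Nat.Properties
open import Data.Nat.Tactic.RingSolver using (solve-∀)
open import Data.Product using (∃; _×_; _,_; proj₁; proj₂)
open import Data.Sum using (_⊎_; inj₁; inj₂)
open import Data.Unit using (⊤; tt)
open import Data.Vec using (Vec; []; _∷_; head; tail; toList; lookup; _∷ʳ_; initLast)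
open import Data.Vec.Properties using (∷-injectiveʳ; ∷ʳ-injectiveˡ; length-toList)
open import Function using (id)
open import Relation.Nullary using (¬_; yes; no)
open import Relation.Binary.PropositionalEquality hiding ([_])
open ≡-Reasoning

-- Having no child or two is a condition on the finished tree. Fixing `m` and `k` beforehand turns
-- it into debts that are settled while the parent map is read: `m` takes no child, `k` exactly one
-- besides 2n+1, every other vertex none or two. A vertex that has received the first of two
-- children owes exactly one more, so a finished tree is recognised by a = 0 alone. The minimal
-- chain can be followed in the same reading, because labels arrive in increasing order and the
-- first child to arrive is the smaller one; hence the current end of the chain has no child yet and
-- still carries its initial demand. All operators appear transposed: a function of the exponents a,
-- b stands for the linear functional with these values on x^a y^b, and `ways s` is the functional
-- defined by the vertices `s` still to come. Linear relations between tails therefore pass through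
-- any common prefix. Since all values lie in ℕ, the relations are stated without subtraction.

variable
  φ ψ : ℕ → ℕ → ℕ

-- The step derivation acting on functionals.

∂ : (ℕ → ℕ → ℕ) → ℕ → ℕ → ℕ
-- At a = 0 or b = 0 the meaningless argument `pred 0` occurs only with coefficient 0.
∂ φ a b = a * φ (pred a) b + b * φ (suc a) (pred b)

∂-cong : (∀ a b → φ a b ≡ ψ a b) → ∀ a b → ∂ φ a b ≡ ∂ ψ a b
∂-cong e a b = cong₂ _+_ (cong (a *_) (e (pred a) b)) (cong (b *_) (e (suc a) (pred b)))

∂-zero : (∀ a b → φ a b ≡ 0) → ∀ a b → ∂ φ a b ≡ 0
∂-zero e a b rewrite e (pred a) b | e (suc a) (pred b) | *-zeroʳ a | *-zeroʳ b = refl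

∂-+ : ∀ φ ψ a b → ∂ (λ a b → φ a b + ψ a b) a b ≡ ∂ φ a b + ∂ ψ a b
∂-+ φ ψ a b = identity a b (φ (pred a) b) (ψ (pred a) b) (φ (suc a) (pred b)) (ψ (suc a) (pred b))
  where
  identity : ∀ a b s t q r → a * (s + t) + b * (q + r) ≡ (a * s + b * q) + (a * t + b * r)
  identity = solve-∀

∂-* : ∀ c φ a b → ∂ (λ a b → c * φ a b) a b ≡ c * ∂ φ a b
∂-* c φ a b = identity a b c (φ (pred a) b) (φ (suc a) (pred b))
  where
  identity : ∀ a b c s t → a * (c * s) + b * (c * t) ≡ c * (a * s + b * t)
  identity = solve-∀

-- ∂ is dual to the derivation δ = ∂/∂x + x ∂/∂y of ℕ[x,y] acting on the monomials x^a y^b,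
-- so these are the Leibniz rules δ(x g) = g + x δ(g) and δ(y g) = x g + y δ(g).
∂-sucˡ : ∀ φ a b → ∂ φ (suc a) b ≡ φ a b + ∂ (λ a b → φ (suc a) b) a b
∂-sucˡ φ zero    b = cong (_+ b * φ 2 (pred b)) (*-identityˡ (φ 0 b))
∂-sucˡ φ (suc a) b = +-assoc (φ (suc a) b) (suc a * φ (suc a) b) _

∂-sucʳ : ∀ φ a b → ∂ φ a (suc b) ≡ φ (suc a) b + ∂ (λ a b → φ a (suc b)) a b
∂-sucʳ φ a zero    = identity (a * φ (pred a) 1) (φ (suc a) 0)
  where
  identity : ∀ s t → s + (t + 0) ≡ t + (s + 0)
  identity = solve-∀
∂-sucʳ φ a (suc b) = identity (a * φ (pred a) (2 + b)) (φ (suc a) (suc b)) (suc b * φ (suc a) (suc b))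
  where
  identity : ∀ s t q → s + (t + q) ≡ t + (s + q)
  identity = solve-∀

X Y : (ℕ → ℕ → ℕ) → ℕ → ℕ → ℕ
X φ a b = φ (suc a) b
Y φ a b = φ a (suc b)

-- Demands, states and the count of completions.

-- How many more children a vertex gets before vertex 2n+1 is attached: none, exactly one, or zero or two.
data Demand : Set where
  none one even : Demand

-- `on τ a b` while the end of the minimal chain can still grow: the current end has demand τ and is not
-- counted in a and b; `off a b` once the chain has ended.  Here a and b count the demands `one` and `even`.
data State : Set where
  off : ℕ → ℕ → State
  on  : Demand → ℕ → ℕ → State

fresh : Demand → (ℕ → ℕ → ℕ) → ℕ → ℕ → ℕ
fresh none φ a b = φ a b
fresh one  φ a b = φ (suc a) b
fresh even φ a b = φ a (suc b)

-- The next vertex becomes a child of the end of the chain. The old end is then an ordinary vertex,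
-- so what is left of its demand enters the counts: nothing after `one`, one child owed after
-- `even`.
attach : Demand → (ℕ → ℕ → ℕ) → ℕ → ℕ → ℕ
attach none φ a b = 0
attach one  φ a b = φ a b
attach even φ a b = φ (suc a) b

-- The list holds the initial demands of the vertices to come; the first `none` is the vertex that
-- terminates the minimal chain.
ways : List Demand → State → ℕ
ways []         (off zero    b) = 1
ways []         (off (suc a) b) = 0
ways []         (on τ a b)      = 0
ways (none ∷ s) (off a b)  = 0
ways (one  ∷ s) (off a b)  = ∂ (λ a b → ways s (off (suc a) b)) a b
ways (even ∷ s) (off a b)  = ∂ (λ a b → ways s (off a (suc b))) a b
ways (none ∷ s) (on τ a b) = attach τ (λ a b → ways s (off a b)) a b
ways (one  ∷ s) (on τ a b) = ∂ (λ a b → ways s (on τ (suc a) b)) a b + attach τ (λ a b → ways s (on one a b)) a b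
ways (even ∷ s) (on τ a b) = ∂ (λ a b → ways s (on τ a (suc b))) a b + attach τ (λ a b → ways s (on even a b)) a b

-- A virtual vertex 0 whose only child is vertex 1.
root : State
root = on one 0 0

evens : ℕ → List Demand
evens j = replicate j even

-- Propagation of second differences through a common prefix.

SecondDifference : (t₀ t₁ t₂ t : List Demand) → State → Set
SecondDifference t₀ t₁ t₂ t S = ways t₂ S + ways t₀ S + 2 * ways t S ≡ 2 * ways t₁ S

∂-difference : ∀ φ₀ φ₁ φ₂ φ → (∀ a b → φ₂ a b + φ₀ a b + 2 * φ a b ≡ 2 * φ₁ a b) →
               ∀ a b → ∂ φ₂ a b + ∂ φ₀ a b + 2 * ∂ φ a b ≡ 2 * ∂ φ₁ a b
∂-difference φ₀ φ₁ φ₂ φ e a b = begin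
  ∂ φ₂ a b + ∂ φ₀ a b + 2 * ∂ φ a b
    ≡⟨ cong₂ _+_ (∂-+ φ₂ φ₀ a b) (∂-* 2 φ a b) ⟨
  ∂ (λ a b → φ₂ a b + φ₀ a b) a b + ∂ (λ a b → 2 * φ a b) a b
    ≡⟨ ∂-+ (λ a b → φ₂ a b + φ₀ a b) (λ a b → 2 * φ a b) a b ⟨
  ∂ (λ a b → φ₂ a b + φ₀ a b + 2 * φ a b) a b
    ≡⟨ ∂-cong e a b ⟩
  ∂ (λ a b → 2 * φ₁ a b) a b
    ≡⟨ ∂-* 2 φ₁ a b ⟩
  2 * ∂ φ₁ a b ∎

attach-difference : ∀ τ φ₀ φ₁ φ₂ φ → (∀ a b → φ₂ a b + φ₀ a b + 2 * φ a b ≡ 2 * φ₁ a b) →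
               ∀ a b → attach τ φ₂ a b + attach τ φ₀ a b + 2 * attach τ φ a b ≡ 2 * attach τ φ₁ a b
attach-difference none φ₀ φ₁ φ₂ φ e a b = refl
attach-difference one  φ₀ φ₁ φ₂ φ e a b = e a b
attach-difference even φ₀ φ₁ φ₂ φ e a b = e (suc a) b

+-difference : ∀ p₀ p₁ p₂ p q₀ q₁ q₂ q → p₂ + p₀ + 2 * p ≡ 2 * p₁ → q₂ + q₀ + 2 * q ≡ 2 * q₁ →
               (p₂ + q₂) + (p₀ + q₀) + 2 * (p + q) ≡ 2 * (p₁ + q₁)
+-difference p₀ p₁ p₂ p q₀ q₁ q₂ q e e′ = begin
  (p₂ + q₂) + (p₀ + q₀) + 2 * (p + q)       ≡⟨ identity p₀ p₂ p q₀ q₂ q ⟩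
  (p₂ + p₀ + 2 * p) + (q₂ + q₀ + 2 * q)     ≡⟨ cong₂ _+_ e e′ ⟩
  2 * p₁ + 2 * q₁                           ≡⟨ *-distribˡ-+ 2 p₁ q₁ ⟨
  2 * (p₁ + q₁)                             ∎
  where
  identity : ∀ p₀ p₂ p q₀ q₂ q → (p₂ + q₂) + (p₀ + q₀) + 2 * (p + q) ≡ (p₂ + p₀ + 2 * p) + (q₂ + q₀ + 2 * q)
  identity = solve-∀

module _ (t₀ t₁ t₂ t : List Demand) (base : ∀ S → SecondDifference t₀ t₁ t₂ t S) where

  -- Each rule of `ways` is linear in the values of the tail. A relation between tails is therefore
  -- needed only for the stretch of the list in which the marked vertex moves.
  difference-prefix : ∀ s S → SecondDifference (s ++ t₀) (s ++ t₁) (s ++ t₂) (s ++ t) S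
  difference-prefix []      S = base S
  difference-prefix (κ ∷ s) S = step κ S
    where
    idle : List Demand → ℕ → ℕ → ℕ
    idle r a b = ways (s ++ r) (off a b)
    live : Demand → List Demand → ℕ → ℕ → ℕ
    live τ r a b = ways (s ++ r) (on τ a b)
    idle-difference : ∀ a b → SecondDifference (s ++ t₀) (s ++ t₁) (s ++ t₂) (s ++ t) (off a b)
    idle-difference a b = difference-prefix s (off a b)
    live-difference : ∀ τ a b → SecondDifference (s ++ t₀) (s ++ t₁) (s ++ t₂) (s ++ t) (on τ a b)
    live-difference τ a b = difference-prefix s (on τ a b)
    step : ∀ κ S → SecondDifference (κ ∷ s ++ t₀) (κ ∷ s ++ t₁) (κ ∷ s ++ t₂) (κ ∷ s ++ t) S
    step none (off a b)  = refl
    step one  (off a b)  = ∂-difference (X (idle t₀)) (X (idle t₁)) (X (idle t₂)) (X (idle t)) (λ a b → idle-difference (suc a) b) a b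
    step even (off a b)  = ∂-difference (Y (idle t₀)) (Y (idle t₁)) (Y (idle t₂)) (Y (idle t)) (λ a b → idle-difference a (suc b)) a b
    step none (on τ a b) = attach-difference τ (idle t₀) (idle t₁) (idle t₂) (idle t) idle-difference a b
    step one  (on τ a b) =
      +-difference (∂ (X (live τ t₀)) a b) (∂ (X (live τ t₁)) a b) (∂ (X (live τ t₂)) a b) (∂ (X (live τ t)) a b)
                   (attach τ (live one t₀) a b) (attach τ (live one t₁) a b) (attach τ (live one t₂) a b) (attach τ (live one t) a b)
        (∂-difference (X (live τ t₀)) (X (live τ t₁)) (X (live τ t₂)) (X (live τ t)) (λ a b → live-difference τ (suc a) b) a b)
        (attach-difference τ (live one t₀) (live one t₁) (live one t₂) (live one t) (live-difference one) a b)
    step even (on τ a b) =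
      +-difference (∂ (Y (live τ t₀)) a b) (∂ (Y (live τ t₁)) a b) (∂ (Y (live τ t₂)) a b) (∂ (Y (live τ t)) a b)
                   (attach τ (live even t₀) a b) (attach τ (live even t₁) a b) (attach τ (live even t₂) a b) (attach τ (live even t) a b)
        (∂-difference (Y (live τ t₀)) (Y (live τ t₁)) (Y (live τ t₂)) (Y (live τ t)) (λ a b → live-difference τ a (suc b)) a b)
        (attach-difference τ (live even t₀) (live even t₁) (live even t₂) (live even t) (live-difference even) a b)

-- The invariant polynomial, and states that admit no completion.

V : ℕ → ℕ → ℕ → ℕ
V j a b = ways (evens j) (off a b)

-- The polynomial 2y − x² is killed by the step derivation and equals 2 at the final point x = 0, y = 1.
V-invariant : ∀ j a b → V j (2 + a) b + 2 * V j a b ≡ 2 * V j a (suc b)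
V-invariant zero    zero    b = refl
V-invariant zero    (suc a) b = refl
V-invariant (suc j) a       b = begin
  ∂ ξ (2 + a) b + 2 * ∂ ξ a b
    ≡⟨ cong (_+ 2 * ∂ ξ a b) (trans (∂-sucˡ ξ (suc a) b) (cong (ξ (suc a) b +_) (∂-sucˡ (λ a b → ξ (suc a) b) a b))) ⟩
  ξ (suc a) b + (ξ (suc a) b + ∂ (λ a b → ξ (2 + a) b) a b) + 2 * ∂ ξ a b
    ≡⟨ identity (ξ (suc a) b) (∂ (λ a b → ξ (2 + a) b) a b) (∂ ξ a b) ⟩
  2 * ξ (suc a) b + (∂ (λ a b → ξ (2 + a) b) a b + 2 * ∂ ξ a b)
    ≡⟨ cong (2 * ξ (suc a) b +_) inner ⟩
  2 * ξ (suc a) b + 2 * ∂ (λ a b → ξ a (suc b)) a b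
    ≡⟨ *-distribˡ-+ 2 (ξ (suc a) b) _ ⟨
  2 * (ξ (suc a) b + ∂ (λ a b → ξ a (suc b)) a b)
    ≡⟨ cong (2 *_) (∂-sucʳ ξ a b) ⟨
  2 * ∂ ξ a (suc b) ∎
  where
  ξ : ℕ → ℕ → ℕ
  ξ a b = V j a (suc b)
  identity : ∀ s t q → s + (s + t) + 2 * q ≡ 2 * s + (t + 2 * q)
  identity = solve-∀
  inner : ∂ (λ a b → ξ (2 + a) b) a b + 2 * ∂ ξ a b ≡ 2 * ∂ (λ a b → ξ a (suc b)) a b
  inner = begin
    ∂ (λ a b → ξ (2 + a) b) a b + 2 * ∂ ξ a b
      ≡⟨ cong (∂ (λ a b → ξ (2 + a) b) a b +_) (∂-* 2 ξ a b) ⟨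
    ∂ (λ a b → ξ (2 + a) b) a b + ∂ (λ a b → 2 * ξ a b) a b
      ≡⟨ ∂-+ (λ a b → ξ (2 + a) b) (λ a b → 2 * ξ a b) a b ⟨
    ∂ (λ a b → ξ (2 + a) b + 2 * ξ a b) a b
      ≡⟨ ∂-cong (λ a b → V-invariant j a (suc b)) a b ⟩
    ∂ (λ a b → 2 * ξ a (suc b)) a b
      ≡⟨ ∂-* 2 (λ a b → ξ a (suc b)) a b ⟩
    2 * ∂ (λ a b → ξ a (suc b)) a b ∎

-- An end that admits no child never hands the chain on, and a list exhausted in a state `on` counts
-- 0.
ways-stuck : ∀ s a b → ways s (on none a b) ≡ 0
ways-stuck []         a b = refl
ways-stuck (none ∷ s) a b = refl
ways-stuck (one  ∷ s) a b = trans (+-identityʳ _) (∂-zero (λ a b → ways-stuck s (suc a) b) a b)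
ways-stuck (even ∷ s) a b = trans (+-identityʳ _) (∂-zero (λ a b → ways-stuck s a (suc b)) a b)

attach-zero : ∀ τ → (∀ a b → φ a b ≡ 0) → ∀ a b → attach τ φ a b ≡ 0
attach-zero none e a b = refl
attach-zero one  e a b = e a b
attach-zero even e a b = e (suc a) b

-- Only a `none` switches the state to `off`, and the empty list counts 0 in a state `on`.
ways-endless : ∀ {s} → All (_≢ none) s → ∀ τ a b → ways s (on τ a b) ≡ 0
ways-endless []                  τ a b = refl
ways-endless {none ∷ s} (e ∷ es) τ a b with () ← e refl
ways-endless {one  ∷ s} (e ∷ es) τ a b =
  cong₂ _+_ (∂-zero (λ a b → ways-endless es τ (suc a) b) a b) (attach-zero τ (ways-endless es one) a b)
ways-endless {even ∷ s} (e ∷ es) τ a b =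
  cong₂ _+_ (∂-zero (λ a b → ways-endless es τ a (suc b)) a b) (attach-zero τ (ways-endless es even) a b)

-- The recurrences (b) and (c) as double commutators.

lower-difference : ∀ j S → SecondDifference (none ∷ even ∷ even ∷ evens j) (even ∷ none ∷ even ∷ evens j)
                                            (even ∷ even ∷ none ∷ evens j) (none ∷ evens j) S
-- In this state, and with an end that admits no child, all four counts vanish. The content lies in
-- the ends with demand `one` and `even`.
lower-difference j (off a b)
  rewrite ∂-zero {λ _ _ → 0} (λ a b → refl) a b
        | ∂-zero {λ a b → ∂ (λ _ _ → 0) a (suc b)} (λ a b → ∂-zero {λ _ _ → 0} (λ a b → refl) a (suc b)) a b = refl
lower-difference j (on none a b)
  rewrite ways-stuck (even ∷ none ∷ even ∷ evens j) a b | ways-stuck (even ∷ even ∷ none ∷ evens j) a b = refl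
-- The terms `DDV` and `∂ (X yV)` balance. What remains is the double commutator x² - 2y, which
-- `V-invariant` evaluates as -2.
lower-difference j (on one a b) = begin
  ∂ (λ a b → ∂ yV a (suc b) + X yV a b) a b + (∂ (X yV) a b + V j (2 + a) b) + DDV + 2 * V j a b
    ≡⟨ cong (λ z → z + (∂ (X yV) a b + V j (2 + a) b) + DDV + 2 * V j a b) (∂-+ (Y (∂ yV)) (X yV) a b) ⟩
  DDV + ∂ (X yV) a b + (∂ (X yV) a b + V j (2 + a) b) + DDV + 2 * V j a b
    ≡⟨ identity DDV (∂ (X yV) a b) (V j (2 + a) b) (V j a b) ⟩
  2 * DDV + 2 * ∂ (X yV) a b + (V j (2 + a) b + 2 * V j a b)
    ≡⟨ cong (2 * DDV + 2 * ∂ (X yV) a b +_) (V-invariant j a b) ⟩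
  2 * DDV + 2 * ∂ (X yV) a b + 2 * yV a b
    ≡⟨ identity′ DDV (∂ (X yV) a b) (yV a b) ⟩
  2 * (DDV + (yV a b + ∂ (X yV) a b))
    ≡⟨ cong (λ z → 2 * (DDV + z)) (∂-sucˡ yV a b) ⟨
  2 * (DDV + ∂ yV (suc a) b) ∎
  where
  yV = Y (V j)
  DDV = ∂ (Y (∂ yV)) a b
  identity : ∀ d q s t → d + q + (q + s) + d + 2 * t ≡ 2 * d + 2 * q + (s + 2 * t)
  identity = solve-∀
  identity′ : ∀ d q s → 2 * d + 2 * q + 2 * s ≡ 2 * (d + (s + q))
  identity′ = solve-∀
lower-difference j (on even a b) = begin
  ∂ (λ a b → ∂ (X yV) a (suc b) + X (X yV) a b) a b + (∂ (X yV) (suc a) b + V j (3 + a) b) + ∂ (Y (∂ yV)) (suc a) b + 2 * V j (suc a) b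
    ≡⟨ cong₂ (λ z z′ → z + z′ + 2 * V j (suc a) b) (cong₂ _+_ t₁-first (cong (_+ V j (3 + a) b) (∂-sucˡ (X yV) a b))) t₂ ⟩
  (q + d) + q + ((x + q) + V j (3 + a) b) + (x + q + (e + (e + d))) + 2 * V j (suc a) b
    ≡⟨ identity d q x e (V j (3 + a) b) (V j (suc a) b) ⟩
  2 * d + 4 * q + 2 * e + 2 * x + (V j (3 + a) b + 2 * V j (suc a) b)
    ≡⟨ cong (2 * d + 4 * q + 2 * e + 2 * x +_) (V-invariant j (suc a) b) ⟩
  2 * d + 4 * q + 2 * e + 2 * x + 2 * x
    ≡⟨ identity′ d q x e ⟩
  2 * ((e + (q + d)) + (x + (x + q)))
    ≡⟨ cong₂ (λ z z′ → 2 * (z + z′)) t₁′ (trans (∂-sucˡ yV (suc a) b) (cong (x +_) (∂-sucˡ (X yV) a b))) ⟨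
  2 * (∂ (λ a b → ∂ yV (suc a) (suc b)) a b + ∂ yV (2 + a) b) ∎
  where
  yV = Y (V j)
  -- Normal forms with the multiplications to the left of the derivations: `V j` applied to x y² δ²,
  -- x² y δ, x y and y² δ of the monomial. The Leibniz rules reduce every term to these and to x³;
  -- what remains is x (x² - 2y), which is `V-invariant` at `suc a`.
  d = ∂ (∂ (X (Y yV))) a b
  q = ∂ (X (X yV)) a b
  x = X yV a b
  e = ∂ (Y yV) a b
  t₁-first : ∂ (λ a b → ∂ (X yV) a (suc b) + X (X yV) a b) a b ≡ (q + d) + q
  t₁-first = begin
    ∂ (λ a b → ∂ (X yV) a (suc b) + X (X yV) a b) a b
      ≡⟨ ∂-+ (Y (∂ (X yV))) (X (X yV)) a b ⟩
    ∂ (Y (∂ (X yV))) a b + q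
      ≡⟨ cong (_+ q) (trans (∂-cong (∂-sucʳ (X yV)) a b) (∂-+ (X (X yV)) (∂ (X (Y yV))) a b)) ⟩
    (q + d) + q ∎
  t₂ : ∂ (Y (∂ yV)) (suc a) b ≡ x + q + (e + (e + d))
  t₂ = begin
    ∂ (Y (∂ yV)) (suc a) b
      ≡⟨ trans (∂-cong (∂-sucʳ yV) (suc a) b) (∂-+ (X yV) (∂ (Y yV)) (suc a) b) ⟩
    ∂ (X yV) (suc a) b + ∂ (∂ (Y yV)) (suc a) b
      ≡⟨ cong₂ _+_ (∂-sucˡ (X yV) a b) (∂-sucˡ (∂ (Y yV)) a b) ⟩
    x + q + (e + ∂ (X (∂ (Y yV))) a b)
      ≡⟨ cong (λ z → x + q + (e + z)) (trans (∂-cong (∂-sucˡ (Y yV)) a b) (∂-+ (Y yV) (∂ (X (Y yV))) a b)) ⟩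
    x + q + (e + (e + d)) ∎
  t₁′ : ∂ (λ a b → ∂ yV (suc a) (suc b)) a b ≡ e + (q + d)
  t₁′ = begin
    ∂ (λ a b → ∂ yV (suc a) (suc b)) a b
      ≡⟨ trans (∂-cong (λ a b → ∂-sucˡ yV a (suc b)) a b) (∂-+ (Y yV) (Y (∂ (X yV))) a b) ⟩
    e + ∂ (Y (∂ (X yV))) a b
      ≡⟨ cong (e +_) (trans (∂-cong (∂-sucʳ (X yV)) a b) (∂-+ (X (X yV)) (∂ (X (Y yV))) a b)) ⟩
    e + (q + d) ∎
  identity : ∀ d q x e s t → (q + d) + q + ((x + q) + s) + (x + q + (e + (e + d))) + 2 * t
                             ≡ 2 * d + 4 * q + 2 * e + 2 * x + (s + 2 * t)
  identity = solve-∀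
  identity′ : ∀ d q x e → 2 * d + 4 * q + 2 * e + 2 * x + 2 * x ≡ 2 * ((e + (q + d)) + (x + (x + q)))
  identity′ = solve-∀

evens-endless : ∀ j → All (_≢ none) (evens j)
evens-endless zero    = []
evens-endless (suc j) = (λ ()) ∷ evens-endless j

-- [y δ, x δ] = (y - x²) δ, and a second commutator with y δ gives x (x² - 2y) δ. In a state `on`
-- all four counts vanish, because no `none` is left to end the chain.
upper-difference : ∀ j S → SecondDifference (one ∷ even ∷ even ∷ evens j) (even ∷ one ∷ even ∷ evens j)
                                            (even ∷ even ∷ one ∷ evens j) (one ∷ evens j) S
upper-difference j (on τ a b)
  rewrite ways-endless {one ∷ even ∷ even ∷ evens j} ((λ ()) ∷ (λ ()) ∷ (λ ()) ∷ evens-endless j) τ a b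
        | ways-endless {even ∷ one ∷ even ∷ evens j} ((λ ()) ∷ (λ ()) ∷ (λ ()) ∷ evens-endless j) τ a b
        | ways-endless {even ∷ even ∷ one ∷ evens j} ((λ ()) ∷ (λ ()) ∷ (λ ()) ∷ evens-endless j) τ a b
        | ways-endless {one ∷ evens j} ((λ ()) ∷ evens-endless j) τ a b = refl
-- In all four lists the vertex read first applies δ before it multiplies, so one `∂` is common to
-- the terms and can be stripped.
upper-difference j (off a b) = ∂-difference (X (∂ (Y (∂ (Y U))))) (Y (∂ (X (∂ (Y U))))) (Y (∂ (Y (∂ (X U))))) (X U) inner a b
  where
  U = V j
  inner : ∀ a b → ∂ (Y (∂ (X U))) a (suc b) + ∂ (Y (∂ (Y U))) (suc a) b + 2 * U (suc a) b ≡ 2 * ∂ (X (∂ (Y U))) a (suc b)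
  inner a b = begin
    ∂ (Y (∂ (X U))) a (suc b) + ∂ (Y (∂ (Y U))) (suc a) b + 2 * U (suc a) b
      ≡⟨ cong₂ (λ z z′ → z + z′ + 2 * U (suc a) b) t₂ t₀ ⟩
    (U (3 + a) b + q) + ((x + q) + (q + d)) + ((x + q) + (e + (e + d))) + 2 * U (suc a) b
      ≡⟨ identity d q x e (U (3 + a) b) (U (suc a) b) ⟩
    2 * d + 4 * q + 2 * e + 2 * x + (U (3 + a) b + 2 * U (suc a) b)
      ≡⟨ cong (2 * d + 4 * q + 2 * e + 2 * x +_) (V-invariant j (suc a) b) ⟩
    2 * d + 4 * q + 2 * e + 2 * x + 2 * x
      ≡⟨ identity′ d q x e ⟩
    2 * ((x + e) + ((x + q) + (q + d)))
      ≡⟨ cong (2 *_) t₁ ⟨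
    2 * ∂ (X (∂ (Y U))) a (suc b) ∎
    where
    d = ∂ (∂ (X (Y (Y U)))) a b
    q = ∂ (X (X (Y U))) a b
    x = X (Y U) a b
    e = ∂ (Y (Y U)) a b
    Y∂∂XY : ∂ (∂ (X (Y U))) a (suc b) ≡ (x + q) + (q + d)
    Y∂∂XY = begin
      ∂ (∂ (X (Y U))) a (suc b)
        ≡⟨ ∂-sucʳ (∂ (X (Y U))) a b ⟩
      ∂ (X (Y U)) (suc a) b + ∂ (Y (∂ (X (Y U)))) a b
        ≡⟨ cong₂ _+_ (∂-sucˡ (X (Y U)) a b) (trans (∂-cong (∂-sucʳ (X (Y U))) a b) (∂-+ (X (X (Y U))) (∂ (X (Y (Y U)))) a b)) ⟩
      (x + q) + (q + d) ∎
    t₂ : ∂ (Y (∂ (X U))) a (suc b) ≡ (U (3 + a) b + q) + ((x + q) + (q + d))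
    t₂ = begin
      ∂ (Y (∂ (X U))) a (suc b)
        ≡⟨ trans (∂-cong (∂-sucʳ (X U)) a (suc b)) (∂-+ (X (X U)) (∂ (X (Y U))) a (suc b)) ⟩
      ∂ (X (X U)) a (suc b) + ∂ (∂ (X (Y U))) a (suc b)
        ≡⟨ cong₂ _+_ (∂-sucʳ (X (X U)) a b) Y∂∂XY ⟩
      (U (3 + a) b + q) + ((x + q) + (q + d)) ∎
    t₀ : ∂ (Y (∂ (Y U))) (suc a) b ≡ (x + q) + (e + (e + d))
    t₀ = begin
      ∂ (Y (∂ (Y U))) (suc a) b
        ≡⟨ trans (∂-cong (∂-sucʳ (Y U)) (suc a) b) (∂-+ (X (Y U)) (∂ (Y (Y U))) (suc a) b) ⟩
      ∂ (X (Y U)) (suc a) b + ∂ (∂ (Y (Y U))) (suc a) b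
        ≡⟨ cong₂ _+_ (∂-sucˡ (X (Y U)) a b) (∂-sucˡ (∂ (Y (Y U))) a b) ⟩
      x + q + (e + ∂ (X (∂ (Y (Y U)))) a b)
        ≡⟨ cong (λ z → x + q + (e + z)) (trans (∂-cong (∂-sucˡ (Y (Y U))) a b) (∂-+ (Y (Y U)) (∂ (X (Y (Y U)))) a b)) ⟩
      x + q + (e + (e + d)) ∎
    t₁ : ∂ (X (∂ (Y U))) a (suc b) ≡ (x + e) + ((x + q) + (q + d))
    t₁ = begin
      ∂ (X (∂ (Y U))) a (suc b)
        ≡⟨ trans (∂-cong (∂-sucˡ (Y U)) a (suc b)) (∂-+ (Y U) (∂ (X (Y U))) a (suc b)) ⟩
      ∂ (Y U) a (suc b) + ∂ (∂ (X (Y U))) a (suc b)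
        ≡⟨ cong₂ _+_ (∂-sucʳ (Y U) a b) Y∂∂XY ⟩
      (x + e) + ((x + q) + (q + d)) ∎
    identity : ∀ d q x e s t → (s + q) + ((x + q) + (q + d)) + ((x + q) + (e + (e + d))) + 2 * t
                               ≡ 2 * d + 4 * q + 2 * e + 2 * x + (s + 2 * t)
    identity = solve-∀
    identity′ : ∀ d q x e → 2 * d + 4 * q + 2 * e + 2 * x + 2 * x ≡ 2 * ((x + e) + ((x + q) + (q + d)))
    identity′ = solve-∀

-- Column 2n, column 2n-1 and row 2n.

attach-cong : ∀ τ → (∀ a b → φ a b ≡ ψ a b) → ∀ a b → attach τ φ a b ≡ attach τ ψ a b
attach-cong none e a b = refl
attach-cong one  e a b = e a b
attach-cong even e a b = e (suc a) b

module _ {t t′ : List Demand} (e : ∀ S → ways t S ≡ ways t′ S) where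

  ways-cong : ∀ s S → ways (s ++ t) S ≡ ways (s ++ t′) S
  ways-cong []         S          = e S
  ways-cong (none ∷ s) (off a b)  = refl
  ways-cong (one  ∷ s) (off a b)  = ∂-cong (λ a b → ways-cong s (off (suc a) b)) a b
  ways-cong (even ∷ s) (off a b)  = ∂-cong (λ a b → ways-cong s (off a (suc b))) a b
  ways-cong (none ∷ s) (on τ a b) = attach-cong τ (λ a b → ways-cong s (off a b)) a b
  ways-cong (one  ∷ s) (on τ a b) =
    cong₂ _+_ (∂-cong (λ a b → ways-cong s (on τ (suc a) b)) a b) (attach-cong τ (λ a b → ways-cong s (on one a b)) a b)
  ways-cong (even ∷ s) (on τ a b) =
    cong₂ _+_ (∂-cong (λ a b → ways-cong s (on τ a (suc b))) a b) (attach-cong τ (λ a b → ways-cong s (on even a b)) a b)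

module _ {t : List Demand} (e : ∀ S → ways t S ≡ 0) where

  ways-zero : ∀ s S → ways (s ++ t) S ≡ 0
  ways-zero []         S          = e S
  ways-zero (none ∷ s) (off a b)  = refl
  ways-zero (one  ∷ s) (off a b)  = ∂-zero (λ a b → ways-zero s (off (suc a) b)) a b
  ways-zero (even ∷ s) (off a b)  = ∂-zero (λ a b → ways-zero s (off a (suc b))) a b
  ways-zero (none ∷ s) (on τ a b) = attach-zero τ (λ a b → ways-zero s (off a b)) a b
  ways-zero (one  ∷ s) (on τ a b) =
    cong₂ _+_ (∂-zero (λ a b → ways-zero s (on τ (suc a) b)) a b) (attach-zero τ (λ a b → ways-zero s (on one a b)) a b)
  ways-zero (even ∷ s) (on τ a b) =
    cong₂ _+_ (∂-zero (λ a b → ways-zero s (on τ a (suc b))) a b) (attach-zero τ (λ a b → ways-zero s (on even a b)) a b)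

-- The last vertex would owe a child that no later vertex can be. This is the zero column 2n.
last-one : ∀ S → ways (one ∷ []) S ≡ 0
last-one (off a b)  = ∂-zero {λ _ _ → 0} (λ _ _ → refl) a b
last-one (on τ a b) = ways-endless {one ∷ []} ((λ ()) ∷ []) τ a b

V₀-suc : ∀ a b → V 0 a (suc b) ≡ V 0 a b
V₀-suc zero    b = refl
V₀-suc (suc a) b = refl

V₁-suc : ∀ a b → V 1 (suc a) b ≡ V 0 a b
V₁-suc a b = begin
  ∂ (Y (V 0)) (suc a) b                 ≡⟨ ∂-sucˡ (Y (V 0)) a b ⟩
  V 0 a (suc b) + ∂ (X (Y (V 0))) a b   ≡⟨ cong₂ _+_ (V₀-suc a b) (∂-zero {X (Y (V 0))} (λ _ _ → refl) a b) ⟩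
  V 0 a b + 0                           ≡⟨ +-identityʳ _ ⟩
  V 0 a b                               ∎

-- The last vertex has to be the child owed by the vertex before it, so the pair does the work of a
-- single childless vertex. With k = 2n-1 this gives column 2n-1.
last-one-even : ∀ S → ways (one ∷ even ∷ []) S ≡ ways (even ∷ []) S
last-one-even (off a b)  = ∂-cong (λ a b → trans (V₁-suc a b) (sym (V₀-suc a b))) a b
last-one-even (on τ a b) = trans (ways-endless {one ∷ even ∷ []} ((λ ()) ∷ (λ ()) ∷ []) τ a b) (sym (ways-endless {even ∷ []} ((λ ()) ∷ []) τ a b))

-- From here on every end of the chain has demand `even`. The last vertex would be the first child
-- of such an end, and no second child can follow.
last-none-even : ∀ i a b → ways (evens i ++ none ∷ []) (on even a b) ≡ 0
last-none-even zero    a b = refl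
last-none-even (suc i) a b = cong₂ _+_ (∂-zero (λ a b → last-none-even i a (suc b)) a b) (last-none-even i (suc a) b)

-- The current end has to wait for the last vertex, since an earlier child would be an end with
-- demand `even`. The other `i` vertices attach elsewhere, as if the chain had ended.
last-none-one : ∀ i a b → ways (evens i ++ none ∷ []) (on one a b) ≡ V i a b
last-none-one zero    a b = refl
last-none-one (suc i) a b =
  trans (cong₂ _+_ (∂-cong (λ a b → last-none-one i a (suc b)) a b) (last-none-even i a b)) (+-identityʳ _)

-- The parent of the last vertex can only be the vertex with demand `one`. Deleting the last vertex
-- makes that parent a leaf and the new end of the chain, so f_n(2n, k) becomes the row sum
-- f_{n-1}(k, •).
last-none : ∀ p i a b → ways (evens p ++ one ∷ evens i ++ none ∷ []) (on even a b) ≡ ways (evens p ++ none ∷ evens i) (on even a b)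
last-none zero    i a b = cong₂ _+_ (∂-zero (λ a b → last-none-even i (suc a) b) a b) (last-none-one i (suc a) b)
last-none (suc p) i a b = cong₂ _+_ (∂-cong (λ a b → last-none p i a (suc b)) a b) (last-none p i (suc a) b)

last-none-root : ∀ p i → ways (evens p ++ one ∷ evens i ++ none ∷ []) root ≡ ways (evens p ++ none ∷ evens i) root
last-none-root zero    i = last-none-one i 0 0
last-none-root (suc p) i = last-none p i 0 0

-- Row sums, column sums and row 2n-1.

sumBelow : ℕ → (ℕ → ℕ) → ℕ
sumBelow zero    g = 0
sumBelow (suc j) g = g 0 + sumBelow j (λ l → g (suc l))

sumBelow-cong : ∀ j {g h : ℕ → ℕ} → (∀ l → l < j → g l ≡ h l) → sumBelow j g ≡ sumBelow j h
sumBelow-cong zero    e = refl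
sumBelow-cong (suc j) e = cong₂ _+_ (e 0 z<s) (sumBelow-cong j (λ l l<j → e (suc l) (s<s l<j)))

sumBelow-+ : ∀ j (g h : ℕ → ℕ) → sumBelow j (λ l → g l + h l) ≡ sumBelow j g + sumBelow j h
sumBelow-+ zero    g h = refl
sumBelow-+ (suc j) g h =
  trans (cong (g 0 + h 0 +_) (sumBelow-+ j (λ l → g (suc l)) (λ l → h (suc l))))
        (identity (g 0) (h 0) (sumBelow j (λ l → g (suc l))) _)
  where
  identity : ∀ s t q r → s + t + (q + r) ≡ s + q + (t + r)
  identity = solve-∀

sumBelow-∂ : ∀ j (χ : ℕ → ℕ → ℕ → ℕ) a b → sumBelow j (λ l → ∂ (χ l) a b) ≡ ∂ (λ a b → sumBelow j (λ l → χ l a b)) a b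
sumBelow-∂ zero    χ a b = sym (∂-zero {λ _ _ → 0} (λ _ _ → refl) a b)
sumBelow-∂ (suc j) χ a b =
  trans (cong (∂ (χ 0) a b +_) (sumBelow-∂ j (λ l → χ (suc l)) a b))
        (sym (∂-+ (χ 0) (λ a b → sumBelow j (λ l → χ (suc l) a b)) a b))

setOne : ℕ → List Demand → List Demand
setOne l       []      = []
setOne zero    (κ ∷ s) = one ∷ s
setOne (suc l) (κ ∷ s) = κ ∷ setOne l s

-- A demand `one` is kept, so that setOne and setNone commute.
setNone : ℕ → List Demand → List Demand
setNone l       []         = []
setNone zero    (none ∷ s) = none ∷ s
setNone zero    (one  ∷ s) = one  ∷ s
setNone zero    (even ∷ s) = none ∷ s
setNone (suc l) (κ    ∷ s) = κ ∷ setNone l s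

-- Classify by the parent of the last of `suc j` vertices and reserve its place from the start. A
-- parent among the first `j` of them gets demand `one`; a parent counted in `a` or `b` has its
-- demand lowered, which gives the summand `∂ (V j)`.
sum-setOne-off : ∀ j a b → sumBelow j (λ l → ways (setOne l (evens j)) (off a b)) + ∂ (V j) a b ≡ V (suc j) a b
sum-setOne-off zero    a b = sym (∂-cong V₀-suc a b)
sum-setOne-off (suc j) a b = begin
  ∂ (X (V j)) a b + sumBelow j (λ l → ∂ (Y (λ a b → ways (setOne l (evens j)) (off a b))) a b) + ∂ (V (suc j)) a b
    ≡⟨ cong (λ z → ∂ (X (V j)) a b + z + ∂ (V (suc j)) a b) (sumBelow-∂ j (λ l → Y (λ a b → ways (setOne l (evens j)) (off a b))) a b) ⟩
  ∂ (X (V j)) a b + ∂ (Y Σ) a b + ∂ (V (suc j)) a b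
    ≡⟨ identity (∂ (X (V j)) a b) (∂ (Y Σ) a b) (∂ (V (suc j)) a b) ⟩
  ∂ (Y Σ) a b + (∂ (X (V j)) a b + ∂ (V (suc j)) a b)
    ≡⟨ cong (∂ (Y Σ) a b +_) (trans (∂-cong (∂-sucʳ (V j)) a b) (∂-+ (X (V j)) (∂ (Y (V j))) a b)) ⟨
  ∂ (Y Σ) a b + ∂ (Y (∂ (V j))) a b
    ≡⟨ ∂-+ (Y Σ) (Y (∂ (V j))) a b ⟨
  ∂ (λ a b → Σ a (suc b) + ∂ (V j) a (suc b)) a b
    ≡⟨ ∂-cong (λ a b → sum-setOne-off j a (suc b)) a b ⟩
  ∂ (Y (V (suc j))) a b ∎
  where
  Σ : ℕ → ℕ → ℕ
  Σ a b = sumBelow j (λ l → ways (setOne l (evens j)) (off a b))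
  identity : ∀ s t q → s + t + q ≡ t + (s + q)
  identity = solve-∀

-- Again by the parent of the last vertex, which may now also be the current end: its demand drops
-- from `even` to `one`. The index l = i overwrites the only `none` and contributes 0.
sum-setOne-on : ∀ i j a b →
  sumBelow (i + suc j) (λ l → ways (setOne l (evens i ++ none ∷ evens j)) (on even a b))
    + ∂ (λ a b → ways (evens i ++ none ∷ evens j) (on even a b)) a b + ways (evens i ++ none ∷ evens j) (on one a b)
  ≡ ways (evens i ++ none ∷ evens (suc j)) (on even a b)
sum-setOne-on zero j a b = begin
  ways (one ∷ evens j) (on even a b) + Σ + ∂ (X (V j)) a b + V j a b
    ≡⟨ cong (λ z → z + Σ + ∂ (X (V j)) a b + V j a b) (ways-endless {one ∷ evens j} ((λ ()) ∷ evens-endless j) even a b) ⟩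
  Σ + ∂ (X (V j)) a b + V j a b
    ≡⟨ trans (+-assoc Σ _ _) (cong (Σ +_) (trans (+-comm _ (V j a b)) (sym (∂-sucˡ (V j) a b)))) ⟩
  Σ + ∂ (V j) (suc a) b
    ≡⟨ sum-setOne-off j (suc a) b ⟩
  V (suc j) (suc a) b ∎
  where
  Σ = sumBelow j (λ l → ways (setOne l (evens j)) (off (suc a) b))
sum-setOne-on (suc i) j a b = begin
  ∂ (X C) a b + X E a b + sumBelow (i + suc j) (λ l → ∂ (Y (C′ l)) a b + X (C′ l) a b)
    + ∂ (λ a b → ∂ (Y C) a b + X C a b) a b + (∂ (Y E) a b + C a b)
    ≡⟨ cong₂ (λ z z′ → ∂ (X C) a b + X E a b + z + z′ + (∂ (Y E) a b + C a b))
         (trans (sumBelow-+ (i + suc j) (λ l → ∂ (Y (C′ l)) a b) (λ l → X (C′ l) a b))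
                (cong (_+ X Σ a b) (sumBelow-∂ (i + suc j) (λ l → Y (C′ l)) a b)))
         (∂-+ (∂ (Y C)) (X C) a b) ⟩
  ∂ (X C) a b + X E a b + (∂ (Y Σ) a b + X Σ a b) + (∂ (∂ (Y C)) a b + ∂ (X C) a b) + (∂ (Y E) a b + C a b)
    ≡⟨ identity (∂ (X C) a b) (X E a b) (∂ (Y Σ) a b) (X Σ a b) (∂ (∂ (Y C)) a b) (∂ (Y E) a b) (C a b) ⟩
  (∂ (Y Σ) a b + (∂ (X C) a b + ∂ (∂ (Y C)) a b) + ∂ (Y E) a b) + (X Σ a b + (C a b + ∂ (X C) a b) + X E a b)
    ≡⟨ cong₂ (λ z z′ → (∂ (Y Σ) a b + z + ∂ (Y E) a b) + (X Σ a b + z′ + X E a b))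
         (trans (∂-cong (∂-sucʳ C) a b) (∂-+ (X C) (∂ (Y C)) a b)) (∂-sucˡ C a b) ⟨
  (∂ (Y Σ) a b + ∂ (Y (∂ C)) a b + ∂ (Y E) a b) + (X Σ a b + X (∂ C) a b + X E a b)
    ≡⟨ cong (_+ (X Σ a b + X (∂ C) a b + X E a b))
         (trans (∂-+ (λ a b → Σ a (suc b) + ∂ C a (suc b)) (Y E) a b) (cong (_+ ∂ (Y E) a b) (∂-+ (Y Σ) (Y (∂ C)) a b))) ⟨
  ∂ (λ a b → Σ a (suc b) + ∂ C a (suc b) + E a (suc b)) a b + (X Σ a b + X (∂ C) a b + X E a b)
    ≡⟨ cong₂ _+_ (∂-cong (λ a b → sum-setOne-on i j a (suc b)) a b) (sum-setOne-on i j (suc a) b) ⟩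
  ways (evens (suc i) ++ none ∷ evens (suc j)) (on even a b) ∎
  where
  C E Σ : ℕ → ℕ → ℕ
  C a b = ways (evens i ++ none ∷ evens j) (on even a b)
  E a b = ways (evens i ++ none ∷ evens j) (on one a b)
  C′ : ℕ → ℕ → ℕ → ℕ
  C′ l a b = ways (setOne l (evens i ++ none ∷ evens j)) (on even a b)
  Σ a b = sumBelow (i + suc j) (λ l → C′ l a b)
  identity : ∀ xc xe ys xs dyc ye c → xc + xe + (ys + xs) + (dyc + xc) + (ye + c) ≡ (ys + (xc + dyc) + ye) + (xs + (c + xc) + xe)
  identity = solve-∀

sum-setOne-root : ∀ p j → sumBelow (p + suc j) (λ l → ways (setOne l (evens p ++ none ∷ evens j)) root)
                          ≡ ways (evens p ++ none ∷ evens (suc j)) root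
sum-setOne-root zero j =
  trans (cong (_+ sumBelow j (λ l → ways (setOne l (evens j)) (off 0 0))) (ways-endless {one ∷ evens j} ((λ ()) ∷ evens-endless j) one 0 0))
        (trans (sym (+-identityʳ _)) (sum-setOne-off j 0 0))
sum-setOne-root (suc p) j =
  trans (trans (+-comm (ways (evens p ++ none ∷ evens j) root) Σ) (cong (_+ ways (evens p ++ none ∷ evens j) root) (sym (+-identityʳ Σ))))
        (sum-setOne-on p j 0 0)
  where
  Σ = sumBelow (p + suc j) (λ l → ways (setOne l (evens p ++ none ∷ evens j)) (on even 0 0))

-- The vertex `none` is the first child of a parent with demand `even`, so the last vertex is the
-- second. Deleting both makes the parent a leaf that ends the chain; it is one of the `i` vertices
-- before them or the current end.
sum-setNone-even : ∀ i a b → ways (evens i ++ none ∷ even ∷ []) (on even a b)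
                             ≡ sumBelow i (λ l → ways (setNone l (evens i)) (on even a b)) + V i a b
sum-setNone-even zero    a b = V₁-suc a b
sum-setNone-even (suc i) a b = begin
  ∂ (λ a b → ways (evens i ++ none ∷ even ∷ []) (on even a (suc b))) a b + ways (evens i ++ none ∷ even ∷ []) (on even (suc a) b)
    ≡⟨ cong₂ _+_ (∂-cong (λ a b → sum-setNone-even i a (suc b)) a b) (sum-setNone-even i (suc a) b) ⟩
  ∂ (λ a b → Σ a (suc b) + V i a (suc b)) a b + (X Σ a b + X (V i) a b)
    ≡⟨ cong (_+ (X Σ a b + X (V i) a b)) (∂-+ (Y Σ) (Y (V i)) a b) ⟩
  ∂ (Y Σ) a b + V (suc i) a b + (X Σ a b + X (V i) a b)
    ≡⟨ identity (∂ (Y Σ) a b) (V (suc i) a b) (X Σ a b) (X (V i) a b) ⟩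
  X (V i) a b + (∂ (Y Σ) a b + X Σ a b) + V (suc i) a b
    ≡⟨ cong (λ z → X (V i) a b + (z + X Σ a b) + V (suc i) a b) (sumBelow-∂ i (λ l → Y (C l)) a b) ⟨
  X (V i) a b + (sumBelow i (λ l → ∂ (Y (C l)) a b) + X Σ a b) + V (suc i) a b
    ≡⟨ cong (λ z → X (V i) a b + z + V (suc i) a b) (sumBelow-+ i (λ l → ∂ (Y (C l)) a b) (λ l → X (C l) a b)) ⟨
  X (V i) a b + sumBelow i (λ l → ∂ (Y (C l)) a b + X (C l) a b) + V (suc i) a b ∎
  where
  C : ℕ → ℕ → ℕ → ℕ
  C l a b = ways (setNone l (evens i)) (on even a b)
  Σ : ℕ → ℕ → ℕ
  Σ a b = sumBelow i (λ l → C l a b)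
  identity : ∀ s t q r → s + t + (q + r) ≡ r + (s + q) + t
  identity = solve-∀

-- If the current end is itself the parent of `none`, its demand `one` is met and the last vertex
-- stays free. This is the summand `V (suc i)`.
sum-setNone-one : ∀ i a b → ways (evens i ++ none ∷ even ∷ []) (on one a b)
                            ≡ sumBelow i (λ l → ways (setNone l (evens i)) (on one a b)) + V (suc i) a b
sum-setNone-one zero    a b = refl
sum-setNone-one (suc i) a b = begin
  ∂ (λ a b → ways (evens i ++ none ∷ even ∷ []) (on one a (suc b))) a b + ways (evens i ++ none ∷ even ∷ []) (on even a b)
    ≡⟨ cong₂ _+_ (∂-cong (λ a b → sum-setNone-one i a (suc b)) a b) (sum-setNone-even i a b) ⟩
  ∂ (λ a b → Σ a (suc b) + V (suc i) a (suc b)) a b + (Σ′ + V i a b)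
    ≡⟨ cong (_+ (Σ′ + V i a b)) (∂-+ (Y Σ) (Y (V (suc i))) a b) ⟩
  ∂ (Y Σ) a b + V (2 + i) a b + (Σ′ + V i a b)
    ≡⟨ identity (∂ (Y Σ) a b) (V (2 + i) a b) Σ′ (V i a b) ⟩
  V i a b + (∂ (Y Σ) a b + Σ′) + V (2 + i) a b
    ≡⟨ cong (λ z → V i a b + (z + Σ′) + V (2 + i) a b) (sumBelow-∂ i (λ l → Y (E l)) a b) ⟨
  V i a b + (sumBelow i (λ l → ∂ (Y (E l)) a b) + Σ′) + V (2 + i) a b
    ≡⟨ cong (λ z → V i a b + z + V (2 + i) a b) (sumBelow-+ i (λ l → ∂ (Y (E l)) a b) (λ l → ways (setNone l (evens i)) (on even a b))) ⟨
  V i a b + sumBelow i (λ l → ∂ (Y (E l)) a b + ways (setNone l (evens i)) (on even a b)) + V (2 + i) a b ∎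
  where
  E : ℕ → ℕ → ℕ → ℕ
  E l a b = ways (setNone l (evens i)) (on one a b)
  Σ : ℕ → ℕ → ℕ
  Σ a b = sumBelow i (λ l → E l a b)
  Σ′ = sumBelow i (λ l → ways (setNone l (evens i)) (on even a b))
  identity : ∀ s t q r → s + t + (q + r) ≡ r + (s + q) + t
  identity = solve-∀

-- By the parent of the penultimate vertex. If its demand is `even`, the last vertex is its other
-- child, and deleting both makes it the end of the chain: a listed vertex (the sum, where index p
-- contributes 0 because `setNone` keeps `one`) or the current end (the `off` term). If it is the
-- vertex with demand `one`, only the penultimate vertex is deleted.
sum-setNone-on : ∀ p i a b →
  ways (evens p ++ one ∷ evens i ++ none ∷ even ∷ []) (on even a b)
  ≡ sumBelow (p + suc i) (λ l → ways (setNone l (evens p ++ one ∷ evens i)) (on even a b))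
    + ways (evens p ++ one ∷ evens i) (off a b) + ways (evens p ++ none ∷ evens (suc i)) (on even a b)
sum-setNone-on zero i a b = begin
  ∂ (λ a b → ways (evens i ++ none ∷ even ∷ []) (on even (suc a) b)) a b + ways (evens i ++ none ∷ even ∷ []) (on one (suc a) b)
    ≡⟨ cong₂ _+_ (∂-cong (λ a b → sum-setNone-even i (suc a) b) a b) (sum-setNone-one i (suc a) b) ⟩
  ∂ (λ a b → Σ (suc a) b + V i (suc a) b) a b + (Σ′ (suc a) b + V (suc i) (suc a) b)
    ≡⟨ cong (_+ (Σ′ (suc a) b + V (suc i) (suc a) b)) (∂-+ (X Σ) (X (V i)) a b) ⟩
  ∂ (X Σ) a b + ∂ (X (V i)) a b + (X Σ′ a b + V (suc i) (suc a) b)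
    ≡⟨ identity (∂ (X Σ) a b) (∂ (X (V i)) a b) (X Σ′ a b) (V (suc i) (suc a) b) ⟩
  0 + (∂ (X Σ) a b + X Σ′ a b) + ∂ (X (V i)) a b + V (suc i) (suc a) b
    ≡⟨ cong₂ (λ z z′ → z + z′ + ∂ (X (V i)) a b + V (suc i) (suc a) b)
         (ways-endless {one ∷ evens i} ((λ ()) ∷ evens-endless i) even a b)
         (trans (sumBelow-+ i (λ l → ∂ (X (C l)) a b) (λ l → ways (setNone l (evens i)) (on one (suc a) b)))
                (cong (_+ X Σ′ a b) (sumBelow-∂ i (λ l → X (C l)) a b))) ⟨
  ways (one ∷ evens i) (on even a b) + sumBelow i (λ l → ways (one ∷ setNone l (evens i)) (on even a b)) + ∂ (X (V i)) a b + V (suc i) (suc a) b ∎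
  where
  C : ℕ → ℕ → ℕ → ℕ
  C l a b = ways (setNone l (evens i)) (on even a b)
  Σ Σ′ : ℕ → ℕ → ℕ
  Σ a b = sumBelow i (λ l → C l a b)
  Σ′ a b = sumBelow i (λ l → ways (setNone l (evens i)) (on one a b))
  identity : ∀ s t q r → s + t + (q + r) ≡ 0 + (s + q) + t + r
  identity = solve-∀
sum-setNone-on (suc p) i a b = begin
  ∂ (λ a b → ways (evens p ++ one ∷ evens i ++ none ∷ even ∷ []) (on even a (suc b))) a b
    + ways (evens p ++ one ∷ evens i ++ none ∷ even ∷ []) (on even (suc a) b)
    ≡⟨ cong₂ _+_ (∂-cong (λ a b → sum-setNone-on p i a (suc b)) a b) (sum-setNone-on p i (suc a) b) ⟩
  ∂ (λ a b → Σ a (suc b) + O a (suc b) + G a (suc b)) a b + (X Σ a b + X O a b + X G a b)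
    ≡⟨ cong (_+ (X Σ a b + X O a b + X G a b))
         (trans (∂-+ (λ a b → Σ a (suc b) + O a (suc b)) (Y G) a b) (cong (_+ ∂ (Y G) a b) (∂-+ (Y Σ) (Y O) a b))) ⟩
  ∂ (Y Σ) a b + ∂ (Y O) a b + ∂ (Y G) a b + (X Σ a b + X O a b + X G a b)
    ≡⟨ identity (∂ (Y Σ) a b) (∂ (Y O) a b) (∂ (Y G) a b) (X Σ a b) (X O a b) (X G a b) ⟩
  X O a b + (∂ (Y Σ) a b + X Σ a b) + ∂ (Y O) a b + (∂ (Y G) a b + X G a b)
    ≡⟨ cong (λ z → X O a b + z + ∂ (Y O) a b + (∂ (Y G) a b + X G a b))
         (trans (sumBelow-+ (p + suc i) (λ l → ∂ (Y (C l)) a b) (λ l → X (C l) a b))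
                (cong (_+ X Σ a b) (sumBelow-∂ (p + suc i) (λ l → Y (C l)) a b))) ⟨
  X O a b + sumBelow (p + suc i) (λ l → ∂ (Y (C l)) a b + X (C l) a b) + ∂ (Y O) a b + (∂ (Y G) a b + X G a b) ∎
  where
  C : ℕ → ℕ → ℕ → ℕ
  C l a b = ways (setNone l (evens p ++ one ∷ evens i)) (on even a b)
  Σ O G : ℕ → ℕ → ℕ
  Σ a b = sumBelow (p + suc i) (λ l → C l a b)
  O a b = ways (evens p ++ one ∷ evens i) (off a b)
  G a b = ways (evens p ++ none ∷ evens (suc i)) (on even a b)
  identity : ∀ ys yo yg xs xo xg → ys + yo + yg + (xs + xo + xg) ≡ xo + (ys + xs) + yo + (yg + xg)
  identity = solve-∀

-- Row 2n-1 for k = `suc p`: the first summand is the row sum f_{n-1}(k, •), the second the column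
-- sum f_{n-1}(•, k), according to whether the end 2n-1 of the chain is a sibling of 2n+1 or of 2n.
sum-setNone-root : ∀ p i →
  ways (evens p ++ one ∷ evens i ++ none ∷ even ∷ []) root
  ≡ ways (evens p ++ none ∷ evens (suc i)) root + sumBelow (p + suc i) (λ l → ways (setNone l (evens p ++ one ∷ evens i)) root)
sum-setNone-root zero i = begin
  ways (evens i ++ none ∷ even ∷ []) root
    ≡⟨ sum-setNone-one i 0 0 ⟩
  Σ + V (suc i) 0 0
    ≡⟨ +-comm Σ _ ⟩
  V (suc i) 0 0 + (0 + Σ)
    ≡⟨ cong (λ z → V (suc i) 0 0 + (z + Σ)) (ways-endless (evens-endless i) one 0 0) ⟨
  V (suc i) 0 0 + (ways (evens i) root + Σ) ∎
  where
  Σ = sumBelow i (λ l → ways (setNone l (evens i)) root)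
sum-setNone-root (suc p) i =
  trans (sum-setNone-on p i 0 0)
        (trans (+-comm (Σ + ways (evens p ++ one ∷ evens i) (off 0 0)) _)
               (cong (ways (evens p ++ none ∷ evens (suc i)) (on even 0 0) +_) (+-comm Σ _)))
  where
  Σ = sumBelow (p + suc i) (λ l → ways (setNone l (evens p ++ one ∷ evens i)) (on even 0 0))

-- Identification of the counts with the Delta sequence.

-- Positions are counted from 0: the vertices m + 1 = eoc and k + 1 = pom among 1, …, N.
schedule : ℕ → ℕ → ℕ → List Demand
schedule N m k = setOne k (setNone m (evens N))

setNone-evens : ∀ p j → setNone p (evens (p + suc j)) ≡ evens p ++ none ∷ evens j
setNone-evens zero    j = refl
setNone-evens (suc p) j = cong (even ∷_) (setNone-evens p j)

setOne-evens : ∀ p j → setOne p (evens (p + suc j)) ≡ evens p ++ one ∷ evens j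
setOne-evens zero    j = refl
setOne-evens (suc p) j = cong (even ∷_) (setOne-evens p j)

setOne-setNone : ∀ N m k → setOne k (setNone m (evens N)) ≡ setNone m (setOne k (evens N))
setOne-setNone zero    m       k       = refl
setOne-setNone (suc N) zero    zero    = refl
setOne-setNone (suc N) zero    (suc k) = refl
setOne-setNone (suc N) (suc m) zero    = refl
setOne-setNone (suc N) (suc m) (suc k) = cong (even ∷_) (setOne-setNone N m k)

schedule-lower : ∀ p i j → schedule (suc (p + i) + suc j) (suc (p + i)) p ≡ evens p ++ one ∷ evens i ++ none ∷ evens j
schedule-lower zero    i j = cong (one ∷_) (setNone-evens i j)
schedule-lower (suc p) i j = cong (even ∷_) (schedule-lower p i j)

schedule-upper : ∀ p i j → schedule (suc (p + i) + suc j) p (suc (p + i)) ≡ evens p ++ none ∷ evens i ++ one ∷ evens j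
schedule-upper zero    i j = cong (none ∷_) (setOne-evens i j)
schedule-upper (suc p) i j = cong (even ∷_) (schedule-upper p i j)

schedule-diagonal : ∀ N p → All (_≢ none) (schedule N p p)
schedule-diagonal zero    p       = []
schedule-diagonal (suc N) zero    = (λ ()) ∷ evens-endless N
schedule-diagonal (suc N) (suc p) = (λ ()) ∷ schedule-diagonal N p

evens-++ : ∀ i s → evens (suc i) ++ s ≡ evens i ++ even ∷ s
evens-++ zero    s = refl
evens-++ (suc i) s = cong (even ∷_) (evens-++ i s)

sumTo-sumBelow : ∀ j g → sumTo j g ≡ sumBelow j (λ l → g (suc l))
sumTo-sumBelow zero    g = refl
sumTo-sumBelow (suc j) g = trans (cong (_+ g (suc j)) (sumTo-sumBelow j g)) (sumBelow-last j (λ l → g (suc l)))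
  where
  sumBelow-last : ∀ j g → sumBelow j g + g j ≡ sumBelow (suc j) g
  sumBelow-last zero    g = +-comm 0 (g 0)
  sumBelow-last (suc j) g = trans (+-assoc (g 0) _ _) (cong (g 0 +_) (sumBelow-last j (λ l → g (suc l))))

-- The recurrence determines the entry of smallest index from the other three, so the induction runs
-- from the last rows and columns towards the diagonal.
difference-cancel : ∀ x y z {t t′} → x + t + 2 * y ≡ 2 * z → x + t′ + 2 * y ≡ 2 * z → t ≡ t′
difference-cancel x y z {t} {t′} e e′ =
  +-cancelˡ-≡ x t t′ (+-cancelʳ-≡ (2 * y) (x + t) (x + t′) (trans e (sym e′)))

shift₁ : ∀ p i j → suc (p + suc i) + (2 + j) ≡ suc (p + i) + (3 + j)
shift₁ = solve-∀

shift₂ : ∀ p i j → suc (p + (2 + i)) + suc j ≡ suc (p + i) + (3 + j)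
shift₂ = solve-∀

gap : ∀ {m n} → m < n → ∃ λ j → m + suc j ≡ n
gap {m} {n} m<n = n ∸ suc m , trans (+-suc m _) (m+[n∸m]≡n m<n)

module _ (f : ℕ → ℕ → ℕ → ℕ) (Δ : IsDeltaSequence f) where

  open IsDeltaSequence Δ

  Match : ℕ → Set
  Match n = ∀ m k → m < 2 * n → k < 2 * n → f n (suc m) (suc k) ≡ ways (schedule (2 * n) m k) root

  match-1 : Match 1
  match-1 0 0 _ _ = m1-11
  match-1 0 1 _ _ = m1-12
  match-1 1 0 _ _ = m1-21
  match-1 1 1 _ _ = m1-22
  match-1 (suc (suc m)) k (s≤s (s≤s ())) _
  match-1 m (suc (suc k)) _ (s≤s (s≤s ()))

  module _ (n : ℕ) (match : Match n) where

    -- The list on the right has 2n+1 entries: after summation over k, vertex 2n+1 has no prescribed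
    -- parent and is read like any other vertex.
    rowSum-ways : ∀ p j → p + suc j ≡ 2 * n → rowSum f n (suc p) ≡ ways (evens p ++ none ∷ evens (suc j)) root
    rowSum-ways p j e = begin
      sumTo (2 * n) (λ k → f n (suc p) k)
        ≡⟨ sumTo-sumBelow (2 * n) _ ⟩
      sumBelow (2 * n) (λ l → f n (suc p) (suc l))
        ≡⟨ sumBelow-cong (2 * n) (λ l l< → match p l (subst (p <_) e (m<m+n p z<s)) l<) ⟩
      sumBelow (2 * n) (λ l → ways (setOne l (setNone p (evens (2 * n)))) root)
        ≡⟨ cong (λ N → sumBelow N (λ l → ways (setOne l (setNone p (evens N))) root)) e ⟨
      sumBelow (p + suc j) (λ l → ways (setOne l (setNone p (evens (p + suc j)))) root)
        ≡⟨ cong (λ s → sumBelow (p + suc j) (λ l → ways (setOne l s) root)) (setNone-evens p j) ⟩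
      sumBelow (p + suc j) (λ l → ways (setOne l (evens p ++ none ∷ evens j)) root)
        ≡⟨ sum-setOne-root p j ⟩
      ways (evens p ++ none ∷ evens (suc j)) root ∎

    colSum-ways : ∀ p i → p + suc i ≡ 2 * n →
                  colSum f n (suc p) ≡ sumBelow (p + suc i) (λ l → ways (setNone l (evens p ++ one ∷ evens i)) root)
    colSum-ways p i e = begin
      sumTo (2 * n) (λ m → f n m (suc p))
        ≡⟨ sumTo-sumBelow (2 * n) _ ⟩
      sumBelow (2 * n) (λ l → f n (suc l) (suc p))
        ≡⟨ sumBelow-cong (2 * n) (λ l l< → trans (match l p l< (subst (p <_) e (m<m+n p z<s)))
                                                  (cong (λ s → ways s root) (setOne-setNone (2 * n) l p))) ⟩
      sumBelow (2 * n) (λ l → ways (setNone l (setOne p (evens (2 * n)))) root)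
        ≡⟨ cong (λ N → sumBelow N (λ l → ways (setNone l (setOne p (evens N))) root)) e ⟨
      sumBelow (p + suc i) (λ l → ways (setNone l (setOne p (evens (p + suc i)))) root)
        ≡⟨ cong (λ s → sumBelow (p + suc i) (λ l → ways (setNone l s) root)) (setOne-evens p i) ⟩
      sumBelow (p + suc i) (λ l → ways (setNone l (evens p ++ one ∷ evens i)) root) ∎

    module _ (1≤n : 1 ≤ n) where

      size : 2 * suc n ≡ 2 + 2 * n
      size = *-suc 2 n

      2≤ : 2 ≤ suc n
      2≤ = s≤s 1≤n

      size∸1 : 2 * suc n ∸ 1 ≡ 1 + 2 * n
      size∸1 = cong (_∸ 1) size

      size∸2 : 2 * suc n ∸ 2 ≡ 2 * n
      size∸2 = cong (_∸ 2) size

      -- Descending induction along column k = `suc p`: `j` is the number of rows below m = 2 + (p +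
      -- i) in the matrix of size 2 + 2n. The last two rows are the cases j = 0 and j = 1.
      match-lower : ∀ j p i → suc (p + i) + suc j ≡ 2 + 2 * n →
                    f (suc n) (2 + (p + i)) (suc p) ≡ ways (evens p ++ one ∷ evens i ++ none ∷ evens j) root
      match-lower zero zero zero e with () ← subst (1 ≤_) (suc-injective (suc-injective (sym e))) (*-mono-≤ (s≤s (z≤n {1})) 1≤n)
      -- One of the prescribed zeros. The count vanishes because, after the deletion in `last-none`,
      -- the chain would have to end at the last vertex.
      match-lower zero (suc p) zero e = begin
        f (suc n) (2 + (suc p + 0)) (2 + p)
          ≡⟨ cong₂ (f (suc n)) (trans (cong suc (+-comm 1 (suc (p + 0)))) (trans e (sym size)))
                               (trans (identity p) (trans (suc-injective e) (sym size∸1))) ⟩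
        f (suc n) (2 * suc n) (2 * suc n ∸ 1)
          ≡⟨ row2na (suc n) 2≤ ⟩
        0
          ≡⟨ last-none-even p 0 0 ⟨
        ways (evens (suc p) ++ none ∷ []) root
          ≡⟨ last-none-root (suc p) 0 ⟨
        ways (evens (suc p) ++ one ∷ none ∷ []) root ∎
        where
        identity : ∀ p → 2 + p ≡ suc p + 0 + 1
        identity = solve-∀
      match-lower zero p (suc i) e = begin
        f (suc n) (2 + (p + suc i)) (suc p)
          ≡⟨ cong (λ z → f (suc n) z (suc p)) (trans (cong (2 +_) e′) (sym size)) ⟩
        f (suc n) (2 * suc n) (suc p)
          ≡⟨ row2n (suc n) 2≤ (suc p) (s≤s z≤n) (subst (p <_) (trans e′ (sym size∸2)) (m<m+n p z<s)) ⟩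
        rowSum f n (suc p)
          ≡⟨ rowSum-ways p i e′ ⟩
        ways (evens p ++ none ∷ evens (suc i)) root
          ≡⟨ last-none-root p (suc i) ⟨
        ways (evens p ++ one ∷ evens (suc i) ++ none ∷ []) root ∎
        where
        e′ : p + suc i ≡ 2 * n
        e′ = suc-injective (suc-injective (trans (cong suc (+-comm 1 (p + suc i))) e))
      match-lower (suc zero) p i e = begin
        f (suc n) (2 + (p + i)) (suc p)
          ≡⟨ cong (λ z → f (suc n) z (suc p)) (trans (cong suc (trans (sym (+-suc p i)) e′)) (sym size∸1)) ⟩
        f (suc n) (2 * suc n ∸ 1) (suc p)
          ≡⟨ row2n-1 (suc n) 2≤ (suc p) (s≤s z≤n) (subst (p <_) (trans e′ (sym size∸2)) (m<m+n p z<s)) ⟩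
        rowSum f n (suc p) + colSum f n (suc p)
          ≡⟨ cong₂ _+_ (rowSum-ways p i e′) (colSum-ways p i e′) ⟩
        ways (evens p ++ none ∷ evens (suc i)) root + sumBelow (p + suc i) (λ l → ways (setNone l (evens p ++ one ∷ evens i)) root)
          ≡⟨ sum-setNone-root p i ⟨
        ways (evens p ++ one ∷ evens i ++ none ∷ even ∷ []) root ∎
        where
        e′ : p + suc i ≡ 2 * n
        e′ = trans (+-suc p i) (suc-injective (suc-injective (trans (cong suc (+-comm 2 (p + i))) e)))
      match-lower (suc (suc j)) p i e = difference-cancel (ways s₂ root) (ways s root) (ways s₁ root)
        (recurrence (match-lower (suc j) p (suc i) (trans (shift₁ p i j) e)) (match-lower j p (2 + i) (trans (shift₂ p i j) e)))
        -- The relation is carried first over `one ∷ evens i` and then over `evens p`; two steps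
        -- match the bracketing of the lists to the right.
        (difference-prefix (one ∷ evens i ++ none ∷ evens (2 + j)) (one ∷ evens i ++ even ∷ none ∷ evens (suc j))
                           (one ∷ evens i ++ even ∷ even ∷ none ∷ evens j) (one ∷ evens i ++ none ∷ evens j)
          (difference-prefix (none ∷ evens (2 + j)) (even ∷ none ∷ evens (suc j)) (even ∷ even ∷ none ∷ evens j) (none ∷ evens j)
            (lower-difference j) (one ∷ evens i))
          (evens p) root)
        where
        m = 2 + (p + i)
        s s₁ s₂ : List Demand
        s = evens p ++ one ∷ evens i ++ none ∷ evens j
        s₁ = evens p ++ one ∷ evens i ++ even ∷ none ∷ evens (suc j)
        s₂ = evens p ++ one ∷ evens i ++ even ∷ even ∷ none ∷ evens j
        e′ : suc (p + i) + suc j ≡ 2 * n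
        e′ = suc-injective (suc-injective (trans (identity (p + i) j) e))
          where
          identity : ∀ q j → 2 + (suc q + suc j) ≡ suc q + (3 + j)
          identity = solve-∀
        f₁ : f (suc n) (2 + (p + suc i)) (suc p) ≡ ways (evens p ++ one ∷ evens (suc i) ++ none ∷ evens (suc j)) root →
             f (suc n) (m + 1) (suc p) ≡ ways s₁ root
        f₁ ih = begin
          f (suc n) (m + 1) (suc p)
            ≡⟨ cong (λ z → f (suc n) z (suc p)) (identity p i) ⟩
          f (suc n) (2 + (p + suc i)) (suc p)
            ≡⟨ ih ⟩
          ways (evens p ++ one ∷ evens (suc i) ++ none ∷ evens (suc j)) root
            ≡⟨ cong (λ z → ways (evens p ++ one ∷ z) root) (evens-++ i _) ⟩
          ways s₁ root ∎
          where
          identity : ∀ p i → 2 + (p + i) + 1 ≡ 2 + (p + suc i)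
          identity = solve-∀
        f₂ : f (suc n) (2 + (p + (2 + i))) (suc p) ≡ ways (evens p ++ one ∷ evens (2 + i) ++ none ∷ evens j) root →
             f (suc n) (m + 2) (suc p) ≡ ways s₂ root
        f₂ ih = begin
          f (suc n) (m + 2) (suc p)
            ≡⟨ cong (λ z → f (suc n) z (suc p)) (identity p i) ⟩
          f (suc n) (2 + (p + (2 + i))) (suc p)
            ≡⟨ ih ⟩
          ways (evens p ++ one ∷ evens (2 + i) ++ none ∷ evens j) root
            ≡⟨ cong (λ z → ways (evens p ++ one ∷ z) root) (trans (evens-++ (suc i) _) (evens-++ i _)) ⟩
          ways s₂ root ∎
          where
          identity : ∀ p i → 2 + (p + i) + 2 ≡ 2 + (p + (2 + i))
          identity = solve-∀
        f₀ : f n m (suc p) ≡ ways s root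
        f₀ = begin
          f n m (suc p)
            ≡⟨ match (suc (p + i)) p m<2n (<-trans (s≤s (m≤m+n p i)) m<2n) ⟩
          ways (schedule (2 * n) (suc (p + i)) p) root
            ≡⟨ cong (λ N → ways (schedule N (suc (p + i)) p) root) e′ ⟨
          ways (schedule (suc (p + i) + suc j) (suc (p + i)) p) root
            ≡⟨ cong (λ z → ways z root) (schedule-lower p i j) ⟩
          ways s root ∎
          where
          m<2n : suc (p + i) < 2 * n
          m<2n = subst (suc (p + i) <_) e′ (m<m+n (suc (p + i)) z<s)
        recurrence : f (suc n) (2 + (p + suc i)) (suc p) ≡ ways (evens p ++ one ∷ evens (suc i) ++ none ∷ evens (suc j)) root →
                     f (suc n) (2 + (p + (2 + i))) (suc p) ≡ ways (evens p ++ one ∷ evens (2 + i) ++ none ∷ evens j) root →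
                     ways s₂ root + f (suc n) m (suc p) + 2 * ways s root ≡ 2 * ways s₁ root
        recurrence ih₁ ih₂ = begin
          ways s₂ root + f (suc n) m (suc p) + 2 * ways s root
            ≡⟨ cong₂ (λ x y → x + f (suc n) m (suc p) + 2 * y) (f₂ ih₂) f₀ ⟨
          f (suc n) (m + 2) (suc p) + f (suc n) m (suc p) + 2 * f n m (suc p)
            ≡⟨ lower (suc n) 2≤ m (suc p) (s≤s (≤-trans (s≤s z≤n) (m≤n+m 1 p)))
                 (s≤s (≤-trans (≤-reflexive (+-comm p 1)) (s≤s (m≤m+n p i))))
                 (≤-trans (m≤m+n m j) (≤-reflexive (trans (identity p i j) (trans e′ (sym size∸2))))) ⟩
          2 * f (suc n) (m + 1) (suc p)
            ≡⟨ cong (2 *_) (f₁ ih₁) ⟩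
          2 * ways s₁ root ∎
          where
          identity : ∀ p i j → 2 + (p + i) + j ≡ suc (p + i) + suc j
          identity = solve-∀

      -- The same descent along row m = `suc p`, with `j` the number of columns after k = 2 + (p +
      -- i).
      match-upper : ∀ j p i → suc (p + i) + suc j ≡ 2 + 2 * n →
                    f (suc n) (suc p) (2 + (p + i)) ≡ ways (evens p ++ none ∷ evens i ++ one ∷ evens j) root
      match-upper zero p i e = begin
        f (suc n) (suc p) (2 + (p + i))
          ≡⟨ cong (f (suc n) (suc p)) 2n ⟩
        f (suc n) (suc p) (2 * suc n)
          ≡⟨ col2n (suc n) 2≤ (suc p) (s≤s z≤n) (subst (suc p ≤_) 2n (s≤s (≤-trans (m≤m+n p i) (n≤1+n _)))) ⟩
        0
          ≡⟨ ways-zero (ways-zero last-one (none ∷ evens i)) (evens p) root ⟨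
        ways (evens p ++ none ∷ evens i ++ one ∷ []) root ∎
        where
        2n : 2 + (p + i) ≡ 2 * suc n
        2n = trans (cong suc (+-comm 1 (p + i))) (trans e (sym size))
      match-upper (suc zero) p i e = begin
        f (suc n) (suc p) (2 + (p + i))
          ≡⟨ cong (f (suc n) (suc p)) (trans (cong suc (trans (sym (+-suc p i)) e′)) (sym size∸1)) ⟩
        f (suc n) (suc p) (2 * suc n ∸ 1)
          ≡⟨ col2n-1 (suc n) 2≤ (suc p) (s≤s z≤n) (subst (p <_) (trans e′ (sym size∸2)) (m<m+n p z<s)) ⟩
        rowSum f n (suc p)
          ≡⟨ rowSum-ways p i e′ ⟩
        ways (evens p ++ none ∷ evens (suc i)) root
          ≡⟨ cong (λ z → ways (evens p ++ none ∷ z) root) (trans (sym (++-identityʳ _)) (evens-++ i [])) ⟩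
        ways (evens p ++ none ∷ evens i ++ even ∷ []) root
          ≡⟨ ways-cong (ways-cong last-one-even (none ∷ evens i)) (evens p) root ⟨
        ways (evens p ++ none ∷ evens i ++ one ∷ even ∷ []) root ∎
        where
        e′ : p + suc i ≡ 2 * n
        e′ = trans (+-suc p i) (suc-injective (suc-injective (trans (cong suc (+-comm 2 (p + i))) e)))
      match-upper (suc (suc j)) p i e = difference-cancel (ways s₂ root) (ways s root) (ways s₁ root)
        (recurrence (match-upper (suc j) p (suc i) (trans (shift₁ p i j) e)) (match-upper j p (2 + i) (trans (shift₂ p i j) e)))
        (difference-prefix (none ∷ evens i ++ one ∷ evens (2 + j)) (none ∷ evens i ++ even ∷ one ∷ evens (suc j))
                           (none ∷ evens i ++ even ∷ even ∷ one ∷ evens j) (none ∷ evens i ++ one ∷ evens j)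
          (difference-prefix (one ∷ evens (2 + j)) (even ∷ one ∷ evens (suc j)) (even ∷ even ∷ one ∷ evens j) (one ∷ evens j)
            (upper-difference j) (none ∷ evens i))
          (evens p) root)
        where
        k = 2 + (p + i)
        s s₁ s₂ : List Demand
        s = evens p ++ none ∷ evens i ++ one ∷ evens j
        s₁ = evens p ++ none ∷ evens i ++ even ∷ one ∷ evens (suc j)
        s₂ = evens p ++ none ∷ evens i ++ even ∷ even ∷ one ∷ evens j
        e′ : suc (p + i) + suc j ≡ 2 * n
        e′ = suc-injective (suc-injective (trans (identity (p + i) j) e))
          where
          identity : ∀ q j → 2 + (suc q + suc j) ≡ suc q + (3 + j)
          identity = solve-∀
        f₁ : f (suc n) (suc p) (2 + (p + suc i)) ≡ ways (evens p ++ none ∷ evens (suc i) ++ one ∷ evens (suc j)) root →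
             f (suc n) (suc p) (k + 1) ≡ ways s₁ root
        f₁ ih = begin
          f (suc n) (suc p) (k + 1)
            ≡⟨ cong (f (suc n) (suc p)) (identity p i) ⟩
          f (suc n) (suc p) (2 + (p + suc i))
            ≡⟨ ih ⟩
          ways (evens p ++ none ∷ evens (suc i) ++ one ∷ evens (suc j)) root
            ≡⟨ cong (λ z → ways (evens p ++ none ∷ z) root) (evens-++ i _) ⟩
          ways s₁ root ∎
          where
          identity : ∀ p i → 2 + (p + i) + 1 ≡ 2 + (p + suc i)
          identity = solve-∀
        f₂ : f (suc n) (suc p) (2 + (p + (2 + i))) ≡ ways (evens p ++ none ∷ evens (2 + i) ++ one ∷ evens j) root →
             f (suc n) (suc p) (k + 2) ≡ ways s₂ root
        f₂ ih = begin
          f (suc n) (suc p) (k + 2)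
            ≡⟨ cong (f (suc n) (suc p)) (identity p i) ⟩
          f (suc n) (suc p) (2 + (p + (2 + i)))
            ≡⟨ ih ⟩
          ways (evens p ++ none ∷ evens (2 + i) ++ one ∷ evens j) root
            ≡⟨ cong (λ z → ways (evens p ++ none ∷ z) root) (trans (evens-++ (suc i) _) (evens-++ i _)) ⟩
          ways s₂ root ∎
          where
          identity : ∀ p i → 2 + (p + i) + 2 ≡ 2 + (p + (2 + i))
          identity = solve-∀
        f₀ : f n (suc p) k ≡ ways s root
        f₀ = begin
          f n (suc p) k
            ≡⟨ match p (suc (p + i)) (<-trans (s≤s (m≤m+n p i)) k<2n) k<2n ⟩
          ways (schedule (2 * n) p (suc (p + i))) root
            ≡⟨ cong (λ N → ways (schedule N p (suc (p + i))) root) e′ ⟨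
          ways (schedule (suc (p + i) + suc j) p (suc (p + i))) root
            ≡⟨ cong (λ z → ways z root) (schedule-upper p i j) ⟩
          ways s root ∎
          where
          k<2n : suc (p + i) < 2 * n
          k<2n = subst (suc (p + i) <_) e′ (m<m+n (suc (p + i)) z<s)
        recurrence : f (suc n) (suc p) (2 + (p + suc i)) ≡ ways (evens p ++ none ∷ evens (suc i) ++ one ∷ evens (suc j)) root →
                     f (suc n) (suc p) (2 + (p + (2 + i))) ≡ ways (evens p ++ none ∷ evens (2 + i) ++ one ∷ evens j) root →
                     ways s₂ root + f (suc n) (suc p) k + 2 * ways s root ≡ 2 * ways s₁ root
        recurrence ih₁ ih₂ = begin
          ways s₂ root + f (suc n) (suc p) k + 2 * ways s root
            ≡⟨ cong₂ (λ x y → x + f (suc n) (suc p) k + 2 * y) (f₂ ih₂) f₀ ⟨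
          f (suc n) (suc p) (k + 2) + f (suc n) (suc p) k + 2 * f n (suc p) k
            ≡⟨ upper (suc n) 2≤ (suc p) k (s≤s (≤-trans (s≤s z≤n) (m≤n+m 1 p)))
                 (s≤s (≤-trans (≤-reflexive (+-comm p 1)) (s≤s (m≤m+n p i))))
                 (≤-trans (m≤m+n k j) (≤-reflexive (trans (identity p i j) (trans e′ (sym size∸2))))) ⟩
          2 * f (suc n) (suc p) (k + 1)
            ≡⟨ cong (2 *_) (f₁ ih₁) ⟩
          2 * ways s₁ root ∎
          where
          identity : ∀ p i j → 2 + (p + i) + j ≡ suc (p + i) + suc j
          identity = solve-∀

      match-suc : Match (suc n)
      match-suc m k m< k< with compare m k
      ... | equal _ = trans (diag (suc n) 2≤ (suc m)) (sym (ways-endless (schedule-diagonal (2 * suc n) m) one 0 0))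
      ... | greater _ i = let j , e = gap m< in
        trans (match-lower j k i (trans e size))
              (trans (cong (λ s → ways s root) (sym (schedule-lower k i j))) (cong (λ N → ways (schedule N m k) root) e))
      ... | less _ i = let j , e = gap k< in
        trans (match-upper j m i (trans e size))
              (trans (cong (λ s → ways s root) (sym (schedule-upper m i j))) (cong (λ N → ways (schedule N m k) root) e))

  delta-ways : ∀ n → Match (suc n)
  delta-ways zero    = match-1
  delta-ways (suc n) = match-suc (suc n) (delta-ways n) (s≤s z≤n)

-- Cardinalities witnessed by enumerations.

Counts : {A : Set} → (A → Set) → ℕ → Set
Counts P c = ∃ λ ts → Unique ts × (∀ x → x ∈ ts → P x) × (∀ x → P x → x ∈ ts) × length ts ≡ c

module _ {A : Set} {P Q : A → Set} where

  counts-⇔ : ∀ {c} → (∀ x → P x → Q x) → (∀ x → Q x → P x) → Counts P c → Counts Q c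
  counts-⇔ to from (ts , unique , sound , complete , size) =
    ts , unique , (λ x x∈ → to x (sound x x∈)) , (λ x q → complete x (from x q)) , size

  counts-⊎ : ∀ {c d} → (∀ x → P x → ¬ Q x) → Counts P c → Counts Q d → Counts (λ x → P x ⊎ Q x) (c + d)
  counts-⊎ disjoint (ts , unique , sound , complete , size) (ts′ , unique′ , sound′ , complete′ , size′) =
    ts ++ ts′ ,
    Unique.++⁺ unique unique′ (λ {x} (x∈ , x∈′) → disjoint x (sound x x∈) (sound′ x x∈′)) ,
    (λ x x∈ → either x (∈-++⁻ ts x∈)) ,
    (λ { x (inj₁ p) → ∈-++⁺ˡ (complete x p) ; x (inj₂ q) → ∈-++⁺ʳ ts (complete′ x q) }) ,
    trans (length-++ ts) (cong₂ _+_ size size′)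
    where
    either : ∀ x → x ∈ ts ⊎ x ∈ ts′ → P x ⊎ Q x
    either x (inj₁ x∈) = inj₁ (sound x x∈)
    either x (inj₂ x∈) = inj₂ (sound′ x x∈)

counts-∅ : {A : Set} {P : A → Set} → (∀ x → ¬ P x) → Counts P 0
counts-∅ empty = [] , [] , (λ _ ()) , (λ x p → ⊥-elim (empty x p)) , refl

counts-≡ : {A : Set} {P : A → Set} → ∀ {c d} → c ≡ d → Counts P c → Counts P d
counts-≡ refl counts = counts

counts-map : {A B : Set} {P : A → Set} (g : A → B) → (∀ {x y} → g x ≡ g y → x ≡ y) →
             ∀ {c} → Counts P c → Counts (λ y → ∃ λ x → P x × y ≡ g x) c
counts-map g injective (ts , unique , sound , complete , size) =
  map g ts ,
  Unique.map⁺ injective unique ,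
  (λ y y∈ → let x , x∈ , e = ∈-map⁻ g y∈ in x , sound x x∈ , e) ,
  (λ { y (x , p , refl) → ∈-map⁺ g (complete x p) }) ,
  trans (length-map g ts) size

sumUpTo : ℕ → (ℕ → ℕ) → ℕ
sumUpTo zero    g = g 0
sumUpTo (suc w) g = sumUpTo w g + g (suc w)

counts-∷ : ∀ {j} {P : Vec ℕ (suc j) → Set} w (c : ℕ → ℕ) → (∀ v → v ≤ w → Counts (λ q → P (v ∷ q)) (c v)) →
           Counts (λ q → head q ≤ w × P q) (sumUpTo w c)
counts-∷ {j} {P} zero c counts = counts-⇔
  (λ { _ (q , p , refl) → z≤n , p })
  (λ { (zero ∷ q) (_ , p) → q , p , refl })
  (counts-map (0 ∷_) ∷-injectiveʳ (counts 0 z≤n))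
counts-∷ {j} {P} (suc w) c counts = counts-⇔
  (λ { _ (inj₁ (v≤w , p)) → m≤n⇒m≤1+n v≤w , p ; _ (inj₂ (q , p , refl)) → ≤-refl , p })
  split
  (counts-⊎ (λ { _ (v≤w , _) (q , _ , refl) → 1+n≰n v≤w })
            (counts-∷ w c (λ v v≤w → counts v (m≤n⇒m≤1+n v≤w)))
            (counts-map (suc w ∷_) ∷-injectiveʳ (counts (suc w) ≤-refl)))
  where
  split : ∀ q → head q ≤ suc w × P q → (head q ≤ w × P q) ⊎ (∃ λ r → P (suc w ∷ r) × q ≡ suc w ∷ r)
  split (v ∷ q) (v≤ , p) with m≤n⇒m<n∨m≡n v≤
  ... | inj₁ (s≤s v≤w) = inj₁ (v≤w , p)
  ... | inj₂ refl      = inj₂ (q , p , refl)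

sumUpTo-cong : ∀ w {g h : ℕ → ℕ} → (∀ v → v ≤ w → g v ≡ h v) → sumUpTo w g ≡ sumUpTo w h
sumUpTo-cong zero    e = e 0 z≤n
sumUpTo-cong (suc w) e = cong₂ _+_ (sumUpTo-cong w (λ v v≤w → e v (m≤n⇒m≤1+n v≤w))) (e (suc w) ≤-refl)

sumUpTo-+ : ∀ w (g h : ℕ → ℕ) → sumUpTo w (λ v → g v + h v) ≡ sumUpTo w g + sumUpTo w h
sumUpTo-+ zero    g h = refl
sumUpTo-+ (suc w) g h = trans (cong (_+ (g (suc w) + h (suc w))) (sumUpTo-+ w g h)) (identity (sumUpTo w g) _ _ _)
  where
  identity : ∀ s t q r → s + t + (q + r) ≡ s + q + (t + r)
  identity = solve-∀

sumUpTo-zero : ∀ w {g : ℕ → ℕ} → (∀ v → v ≤ w → g v ≡ 0) → sumUpTo w g ≡ 0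
sumUpTo-zero zero    e = e 0 z≤n
sumUpTo-zero (suc w) e = cong₂ _+_ (sumUpTo-zero w (λ v v≤w → e v (m≤n⇒m≤1+n v≤w))) (e (suc w) ≤-refl)

sumUpTo≡0 : ∀ w {g : ℕ → ℕ} → sumUpTo w g ≡ 0 → ∀ v → v ≤ w → g v ≡ 0
sumUpTo≡0 zero        e zero z≤n = e
sumUpTo≡0 (suc w) {g} e v    v≤ with m≤n⇒m<n∨m≡n v≤
... | inj₁ (s≤s v≤w) = sumUpTo≡0 w (m+n≡0⇒m≡0 _ e) v v≤w
... | inj₂ refl      = m+n≡0⇒n≡0 (sumUpTo w g) e

≡ᵇ-refl : ∀ v → (v ≡ᵇ v) ≡ true
≡ᵇ-refl zero    = refl
≡ᵇ-refl (suc v) = ≡ᵇ-refl v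

≡ᵇ-≢ : ∀ {x v} → x ≢ v → (x ≡ᵇ v) ≡ false
≡ᵇ-≢ {zero}  {zero}  x≢v = ⊥-elim (x≢v refl)
≡ᵇ-≢ {zero}  {suc v} x≢v = refl
≡ᵇ-≢ {suc x} {zero}  x≢v = refl
≡ᵇ-≢ {suc x} {suc v} x≢v = ≡ᵇ-≢ (λ e → x≢v (cong suc e))

sumUpTo-single : ∀ w u z → u ≤ w → sumUpTo w (λ v → if v ≡ᵇ u then z else 0) ≡ z
sumUpTo-single zero    zero z z≤n = refl
sumUpTo-single (suc w) u    z u≤ with m≤n⇒m<n∨m≡n u≤
... | inj₁ (s≤s u≤w) = trans (cong₂ _+_ (sumUpTo-single w u z u≤w)
                               (cong (λ t → if t then z else 0) (≡ᵇ-≢ (λ e → 1+n≰n (subst (_≤ w) (sym e) u≤w))))) (+-identityʳ z)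
... | inj₂ refl = cong₂ _+_ (sumUpTo-zero w (λ v v≤w → cong (λ t → if t then z else 0) (≡ᵇ-≢ (λ e → 1+n≰n (subst (_≤ w) e v≤w)))))
                            (cong (λ t → if t then z else 0) (≡ᵇ-refl (suc w)))

-- Demands as functions of the label.

_[_≔_] : (ℕ → Demand) → ℕ → Demand → ℕ → Demand
(σ [ v ≔ τ ]) x = if x ≡ᵇ v then τ else σ x

≔-same : ∀ σ v τ → (σ [ v ≔ τ ]) v ≡ τ
≔-same σ v τ = cong (λ t → if t then τ else σ v) (≡ᵇ-refl v)

≔-other : ∀ σ {v x} τ → x ≢ v → (σ [ v ≔ τ ]) x ≡ σ x
≔-other σ {v} {x} τ x≢v = cong (λ t → if t then τ else σ x) (≡ᵇ-≢ x≢v)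

≔-swap : ∀ σ {u v} τ τ′ → u ≢ v → ∀ x → (σ [ v ≔ τ ] [ u ≔ τ′ ]) x ≡ (σ [ u ≔ τ′ ] [ v ≔ τ ]) x
≔-swap σ {u} {v} τ τ′ u≢v x with x ≟ u
... | yes refl = trans (≔-same (σ [ v ≔ τ ]) x τ′) (sym (trans (≔-other (σ [ x ≔ τ′ ]) τ u≢v) (≔-same σ x τ′)))
... | no x≢u with x ≟ v
...   | yes refl = trans (≔-other (σ [ x ≔ τ ]) τ′ x≢u) (trans (≔-same σ x τ) (sym (≔-same (σ [ u ≔ τ′ ]) x τ)))
...   | no x≢v = trans (≔-other (σ [ v ≔ τ ]) τ′ x≢u)
                   (trans (≔-other σ τ x≢v) (sym (trans (≔-other (σ [ u ≔ τ′ ]) τ x≢v) (≔-other σ τ′ x≢u))))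

sumUpTo-≔ : ∀ (g : Demand → ℕ) σ v τ w → v ≤ w →
            sumUpTo w (λ x → g ((σ [ v ≔ τ ]) x)) + g (σ v) ≡ sumUpTo w (λ x → g (σ x)) + g τ
sumUpTo-≔ g σ zero τ zero z≤n = +-comm (g τ) (g (σ 0))
sumUpTo-≔ g σ v τ (suc w) v≤ with m≤n⇒m<n∨m≡n v≤
... | inj₁ (s≤s v≤w) = begin
  s′ + g ((σ [ v ≔ τ ]) (suc w)) + g (σ v)  ≡⟨ cong (λ t → s′ + g t + g (σ v)) (≔-other σ τ (λ e → 1+n≰n (subst (_≤ w) (sym e) v≤w))) ⟩
  s′ + g (σ (suc w)) + g (σ v)              ≡⟨ swap s′ _ _ ⟩
  s′ + g (σ v) + g (σ (suc w))              ≡⟨ cong (_+ g (σ (suc w))) (sumUpTo-≔ g σ v τ w v≤w) ⟩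
  s + g τ + g (σ (suc w))                   ≡⟨ swap s _ _ ⟩
  s + g (σ (suc w)) + g τ                   ∎
  where
  s = sumUpTo w (λ x → g (σ x))
  s′ = sumUpTo w (λ x → g ((σ [ v ≔ τ ]) x))
  swap : ∀ x y z → x + y + z ≡ x + z + y
  swap = solve-∀
... | inj₂ refl = begin
  s′ + g ((σ [ suc w ≔ τ ]) (suc w)) + g (σ (suc w))
    ≡⟨ cong₂ (λ z t → z + g t + g (σ (suc w))) unchanged (≔-same σ (suc w) τ) ⟩
  s + g τ + g (σ (suc w))   ≡⟨ swap s _ _ ⟩
  s + g (σ (suc w)) + g τ   ∎
  where
  s = sumUpTo w (λ x → g (σ x))
  s′ = sumUpTo w (λ x → g ((σ [ v ≔ τ ]) x))
  swap : ∀ x y z → x + y + z ≡ x + z + y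
  swap = solve-∀
  unchanged : s′ ≡ s
  unchanged = sumUpTo-cong w (λ x x≤w → cong g (≔-other σ τ (λ e → 1+n≰n (subst (_≤ w) e x≤w))))

weigh : Demand → ℕ → ℕ → ℕ
weigh none x y = 0
weigh one  x y = x
weigh even x y = y

ones twos : (ℕ → Demand) → ℕ → ℕ
ones σ w = sumUpTo w (λ v → weigh (σ v) 1 0)
twos σ w = sumUpTo w (λ v → weigh (σ v) 0 1)

weigh-linear : ∀ τ x y → weigh τ x y ≡ weigh τ 1 0 * x + weigh τ 0 1 * y
weigh-linear none x y = refl
weigh-linear one  x y = sym (trans (+-identityʳ (x + 0)) (+-identityʳ x))
weigh-linear even x y = sym (+-identityʳ y)

-- Let `x` and `y` be the counts that follow the choice of a parent with demand `one` or `even`.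
-- Then the right side is the formula of `∂` at (`ones σ w`, `twos σ w`): this is where a sum over
-- parents becomes the derivation.
sumUpTo-weigh : ∀ σ w x y → sumUpTo w (λ v → weigh (σ v) x y) ≡ ones σ w * x + twos σ w * y
sumUpTo-weigh σ zero x y = weigh-linear (σ 0) x y
sumUpTo-weigh σ (suc w) x y = trans (cong₂ _+_ (sumUpTo-weigh σ w x y) (weigh-linear (σ (suc w)) x y)) (identity (ones σ w) (twos σ w) (weigh (σ (suc w)) 1 0) _ x y)
  where
  identity : ∀ p q r s x y → p * x + q * y + (r * x + s * y) ≡ (p + r) * x + (q + s) * y
  identity = solve-∀

Allowed : Demand → ℕ → Set
Allowed none c = c ≡ 0
Allowed one  c = c ≡ 1
Allowed even c = c ≡ 0 ⊎ c ≡ 2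

next : Demand → Demand
next none = none
next one  = none
next even = one

allowed-pred : ∀ τ {c} → Allowed τ (suc c) → τ ≢ none × Allowed (next τ) c
allowed-pred none ()
allowed-pred one  refl        = (λ ()) , refl
allowed-pred even (inj₂ refl) = (λ ()) , refl

allowed-suc : ∀ τ {c} → τ ≢ none → Allowed (next τ) c → Allowed τ (suc c)
allowed-suc none τ≢ _    = ⊥-elim (τ≢ refl)
allowed-suc one  τ≢ refl = refl
allowed-suc even τ≢ refl = inj₂ refl

-- `count` branches on the boolean of `v ≟ v`, which is `v ≡ᵇ v` by computation.
childCount-hit : ∀ {j} v (q : Vec ℕ j) → childCount (v ∷ q) v ≡ suc (childCount q v)
childCount-hit v q = cong (λ t → (if t then suc else id) (childCount q v)) (≡ᵇ-refl v)

childCount-miss : ∀ {j} {x v} (q : Vec ℕ j) → x ≢ v → childCount (x ∷ q) v ≡ childCount q v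
childCount-miss {v = v} q x≢v = cong (λ t → (if t then suc else id) (childCount q v)) (≡ᵇ-≢ x≢v)

Fits : ∀ {j} → (ℕ → Demand) → Vec ℕ j → Set
Fits σ q = ∀ v → Allowed (σ v) (childCount q v)

fits-tail : ∀ {j} σ v (q : Vec ℕ j) → Fits σ (v ∷ q) → σ v ≢ none × Fits (σ [ v ≔ next (σ v) ]) q
fits-tail σ v q fits = proj₁ pred-v , rest
  where
  pred-v = allowed-pred (σ v) (subst (Allowed (σ v)) (childCount-hit v q) (fits v))
  rest : Fits (σ [ v ≔ next (σ v) ]) q
  rest x with x ≟ v
  ... | yes refl = subst (λ τ → Allowed τ (childCount q x)) (sym (≔-same σ x _)) (proj₂ pred-v)
  ... | no x≢v = subst₂ Allowed (sym (≔-other σ _ x≢v)) (childCount-miss q (λ e → x≢v (sym e))) (fits x)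

fits-cons : ∀ {j} σ v (q : Vec ℕ j) → σ v ≢ none → Fits (σ [ v ≔ next (σ v) ]) q → Fits σ (v ∷ q)
fits-cons σ v q σv≢ fits x with x ≟ v
... | yes refl = subst (Allowed (σ x)) (sym (childCount-hit x q))
                   (allowed-suc (σ x) σv≢ (subst (λ τ → Allowed τ (childCount q x)) (≔-same σ x _) (fits x)))
... | no x≢v = subst₂ Allowed (≔-other σ _ x≢v) (sym (childCount-miss q (λ e → x≢v (sym e)))) (fits x)

-- The minimal chain read in one pass.

Bounded : ℕ → List ℕ → Set
Bounded w []       = ⊤
Bounded w (x ∷ xs) = x ≤ w × Bounded (suc w) xs

-- The end of the minimal chain in one pass: u is the end of the chain among the vertices 1, …, w,
-- and the list contains the parents of w + 1, w + 2, ….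
scan : List ℕ → ℕ → ℕ → ℕ
scan []       w u = u
scan (x ∷ xs) w u = if x ≡ᵇ u then scan xs (suc w) (suc w) else scan xs (suc w) u

scan-hit : ∀ xs w u → scan (u ∷ xs) w u ≡ scan xs (suc w) (suc w)
scan-hit xs w u = cong (λ t → if t then scan xs (suc w) (suc w) else scan xs (suc w) u) (≡ᵇ-refl u)

scan-miss : ∀ {x} xs w {u} → x ≢ u → scan (x ∷ xs) w u ≡ scan xs (suc w) u
scan-miss xs w {u} x≢u = cong (λ t → if t then scan xs (suc w) (suc w) else scan xs (suc w) u) (≡ᵇ-≢ x≢u)

scan-range : ∀ xs w u → scan xs w u ≡ u ⊎ w < scan xs w u
scan-range []       w u = inj₁ refl
scan-range (x ∷ xs) w u with x ≟ u
... | yes refl rewrite scan-hit xs w x with scan-range xs (suc w) (suc w)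
...   | inj₁ e = inj₂ (≤-reflexive (sym e))
...   | inj₂ l = inj₂ (<⇒≤ l)
scan-range (x ∷ xs) w u | no x≢u rewrite scan-miss xs w x≢u with scan-range xs (suc w) u
...   | inj₁ e = inj₁ e
...   | inj₂ l = inj₂ (<⇒≤ l)

scan-childless : ∀ {j} (q : Vec ℕ j) w u → childCount q u ≡ 0 → scan (toList q) w u ≡ u
scan-childless []      w u e = refl
scan-childless (x ∷ q) w u e with x ≟ u
... | yes refl with () ← trans (sym (childCount-hit x q)) e
... | no x≢u = trans (scan-miss (toList q) w x≢u) (scan-childless q (suc w) u (trans (sym (childCount-miss q x≢u)) e))

-- A parent read at stage w is at most w, whereas the final end is the current end or a label
-- greater than w; and a child of the current end moves the chain on. So no entry of the list is the
-- final end.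
childCount-scan : ∀ {j} (q : Vec ℕ j) w u → Bounded w (toList q) → childCount q (scan (toList q) w u) ≡ 0
childCount-scan []      w u _ = refl
childCount-scan (x ∷ q) w u (x≤w , bounded) with x ≟ u
... | yes refl rewrite scan-hit (toList q) w x =
  trans (childCount-miss q (x≢ (scan-range (toList q) (suc w) (suc w)))) (childCount-scan q (suc w) (suc w) bounded)
  where
  x≢ : ∀ {r} → r ≡ suc w ⊎ suc w < r → x ≢ r
  x≢ (inj₁ refl) refl = 1+n≰n x≤w
  x≢ (inj₂ l)    refl = 1+n≰n (≤-trans (<⇒≤ l) x≤w)
... | no x≢u rewrite scan-miss (toList q) w x≢u =
  trans (childCount-miss q (x≢ (scan-range (toList q) (suc w) u))) (childCount-scan q (suc w) u bounded)
  where
  x≢ : ∀ {r} → r ≡ u ⊎ suc w < r → x ≢ r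
  x≢ (inj₁ refl) refl = x≢u refl
  x≢ (inj₂ l)    refl = 1+n≰n (≤-trans (<⇒≤ l) x≤w)

-- Counting parent vectors with prescribed demands.

ones-≔ : ∀ σ {v} τ {w} → v ≤ w → ones (σ [ v ≔ τ ]) w + weigh (σ v) 1 0 ≡ ones σ w + weigh τ 1 0
ones-≔ σ τ v≤w = sumUpTo-≔ (λ τ → weigh τ 1 0) σ _ τ _ v≤w

twos-≔ : ∀ σ {v} τ {w} → v ≤ w → twos (σ [ v ≔ τ ]) w + weigh (σ v) 0 1 ≡ twos σ w + weigh τ 0 1
twos-≔ σ τ v≤w = sumUpTo-≔ (λ τ → weigh τ 0 1) σ _ τ _ v≤w

ones-cong : ∀ {σ σ′} w → (∀ x → x ≤ w → σ x ≡ σ′ x) → ones σ w ≡ ones σ′ w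
ones-cong w e = sumUpTo-cong w (λ x x≤w → cong (λ τ → weigh τ 1 0) (e x x≤w))

twos-cong : ∀ {σ σ′} w → (∀ x → x ≤ w → σ x ≡ σ′ x) → twos σ w ≡ twos σ′ w
twos-cong w e = sumUpTo-cong w (λ x x≤w → cong (λ τ → weigh τ 0 1) (e x x≤w))

fresh-ones-twos : ∀ Φ ρ w {κ} → ρ (suc w) ≡ κ → Φ (ones ρ (suc w)) (twos ρ (suc w)) ≡ fresh κ Φ (ones ρ w) (twos ρ w)
fresh-ones-twos Φ ρ w refl with ρ (suc w)
... | none = cong₂ Φ (+-identityʳ _) (+-identityʳ _)
... | one  = cong₂ Φ (+-comm _ 1) (+-identityʳ _)
... | even = cong₂ Φ (+-identityʳ _) (+-comm _ 1)

v≢1+w : ∀ {v w} → v ≤ w → v ≢ suc w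
v≢1+w v≤w refl = 1+n≰n v≤w

-- Attaching the next vertex to `v` removes a `one` or turns an `even` into a `one`. These are the
-- two monomials of δ(x^a y^b), and `fresh κ` multiplies by the variable of the new vertex.
branch : ∀ Φ ρ {v w κ} → v ≤ w → ρ (suc w) ≡ κ → ∀ {τ} → ρ v ≡ τ → τ ≢ none →
         Φ (ones (ρ [ v ≔ next τ ]) (suc w)) (twos (ρ [ v ≔ next τ ]) (suc w))
         ≡ weigh τ (fresh κ Φ (pred (ones ρ w)) (twos ρ w)) (fresh κ Φ (suc (ones ρ w)) (pred (twos ρ w)))
branch Φ ρ {v} {w} {κ} v≤w eκ {τ} eτ τ≢ =
  trans (fresh-ones-twos Φ (ρ [ v ≔ next τ ]) w (trans (≔-other ρ _ (λ e → v≢1+w v≤w (sym e))) eκ)) (step τ eτ τ≢)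
  where
  step : ∀ τ → ρ v ≡ τ → τ ≢ none → fresh κ Φ (ones (ρ [ v ≔ next τ ]) w) (twos (ρ [ v ≔ next τ ]) w)
         ≡ weigh τ (fresh κ Φ (pred (ones ρ w)) (twos ρ w)) (fresh κ Φ (suc (ones ρ w)) (pred (twos ρ w)))
  step none _ τ≢ = ⊥-elim (τ≢ refl)
  step one  e _  = cong₂ (fresh κ Φ)
    (cong pred (trans (+-comm 1 _) (trans (subst (λ τ → ones (ρ [ v ≔ none ]) w + weigh τ 1 0 ≡ ones ρ w + 0) e (ones-≔ ρ none v≤w)) (+-identityʳ _))))
    (+-cancelʳ-≡ 0 _ _ (subst (λ τ → twos (ρ [ v ≔ none ]) w + weigh τ 0 1 ≡ twos ρ w + 0) e (twos-≔ ρ none v≤w)))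
  step even e _  = cong₂ (fresh κ Φ)
    (trans (sym (+-identityʳ _)) (trans (subst (λ τ → ones (ρ [ v ≔ one ]) w + weigh τ 1 0 ≡ ones ρ w + 1) e (ones-≔ ρ one v≤w)) (+-comm _ 1)))
    (cong pred (trans (+-comm 1 _) (trans (subst (λ τ → twos (ρ [ v ≔ one ]) w + weigh τ 0 1 ≡ twos ρ w + 0) e (twos-≔ ρ one v≤w)) (+-identityʳ _))))

-- The counts of a state `on` leave out the end `u`. When the chain moves on, `u` is counted again
-- with demand `next τ`, which adds a `one` exactly for τ = `even`.
attach-ones-twos : ∀ Φ σ {u w} → u ≤ w → ∀ τ → τ ≢ none →
                   Φ (ones (σ [ u ≔ next τ ]) w) (twos (σ [ u ≔ next τ ]) w)
                   ≡ attach τ Φ (ones (σ [ u ≔ none ]) w) (twos (σ [ u ≔ none ]) w)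
attach-ones-twos Φ σ u≤w none τ≢ = ⊥-elim (τ≢ refl)
attach-ones-twos Φ σ u≤w one  τ≢ = refl
attach-ones-twos Φ σ {u} {w} u≤w even τ≢ = cong₂ Φ
  (+-cancelʳ-≡ (weigh (σ u) 1 0) _ _ (trans (ones-≔ σ one u≤w)
    (trans (+-comm _ 1) (cong suc (trans (sym (+-identityʳ _)) (sym (ones-≔ σ none u≤w)))))))
  (+-cancelʳ-≡ (weigh (σ u) 0 1) _ _ (trans (twos-≔ σ one u≤w) (sym (twos-≔ σ none u≤w))))

-- There is no condition on the chain: once its end has been read, the demand `none` of that vertex
-- keeps the chain from growing.
GoodOff : ∀ {j} → ℕ → (ℕ → Demand) → Vec ℕ j → Set
GoodOff w σ q = Bounded w (toList q) × Fits σ q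

module _ (m : ℕ) where

  -- The two implications tie the terminating `none` of the list to the label `m`. The clause for
  -- the empty list lets all labels beyond the vertices read fit with no child.
  Agree : ℕ → List Demand → (ℕ → Demand) → Set
  Agree w []      σ = ∀ v → w < v → σ v ≡ even
  Agree w (κ ∷ s) σ = σ (suc w) ≡ κ × (κ ≡ none → suc w ≡ m) × (suc w ≡ m → κ ≡ none) × Agree (suc w) s σ

  agree-≔ : ∀ s {w σ v} τ → v ≤ w → Agree w s σ → Agree w s (σ [ v ≔ τ ])
  agree-≔ []      {σ = σ} τ v≤w agree x w<x = trans (≔-other σ τ (λ { refl → 1+n≰n (≤-trans w<x v≤w) })) (agree x w<x)
  agree-≔ (κ ∷ s) {σ = σ} τ v≤w (e , to , from , agree) =
    trans (≔-other σ τ (λ e → v≢1+w v≤w (sym e))) e , to , from , agree-≔ s τ (m≤n⇒m≤1+n v≤w) agree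

  GoodOn : ∀ {j} → ℕ → ℕ → (ℕ → Demand) → Vec ℕ j → Set
  GoodOn w u σ q = Bounded w (toList q) × Fits σ q × scan (toList q) w u ≡ m

  counts-off : ∀ s w σ → Agree w s σ → m ≤ w →
               Counts {Vec ℕ (length s)} (GoodOff w σ) (ways s (off (ones σ w) (twos σ w)))
  counts-off-step : ∀ κ s w σ → Agree w (κ ∷ s) σ → m ≤ w →
                    Counts {Vec ℕ (suc (length s))} (GoodOff w σ) (∂ (fresh κ (λ a b → ways s (off a b))) (ones σ w) (twos σ w))

  counts-off [] w σ agree m≤w with ones σ w in e
  ... | zero = ([] ∷ []) , ([] ∷ []) , (λ { [] _ → tt , fits }) , (λ { [] _ → here refl }) , refl
    where
    allowed-0 : ∀ τ → weigh τ 1 0 ≡ 0 → Allowed τ 0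
    allowed-0 none _ = refl
    allowed-0 even _ = inj₁ refl
    fits : Fits σ []
    fits v with v ≤? w
    ... | yes v≤w = allowed-0 (σ v) (sumUpTo≡0 w e v v≤w)
    ... | no  v≰w = subst (λ τ → Allowed τ 0) (sym (agree v (≰⇒> v≰w))) (inj₁ refl)
  ... | suc _ = counts-∅ absurd
    where
    no-one : ∀ τ → Allowed τ 0 → weigh τ 1 0 ≡ 0
    no-one none _ = refl
    no-one even _ = refl
    absurd : ∀ q → ¬ GoodOff w σ q
    absurd [] (_ , fits) with () ← trans (sym e) (sumUpTo-zero w (λ v _ → no-one (σ v) (fits v)))
  counts-off (none ∷ s) w σ (_ , to , _) m≤w = ⊥-elim (1+n≰n (≤-trans (≤-reflexive (to refl)) m≤w))
  counts-off (one  ∷ s) w σ agree m≤w = counts-off-step one  s w σ agree m≤w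
  counts-off (even ∷ s) w σ agree m≤w = counts-off-step even s w σ agree m≤w

  counts-off-step κ s w σ (eκ , _ , _ , agree) m≤w =
    counts-≡ (sumUpTo-weigh σ w x y)
      (counts-⇔ {P = λ q → head q ≤ w × Good′ q} (λ { (v ∷ q) (v≤w , bounded , fits) → (v≤w , bounded) , fits })
                (λ { (v ∷ q) ((v≤w , bounded) , fits) → v≤w , bounded , fits })
        (counts-∷ w (λ v → weigh (σ v) x y) each))
    where
    Φ : ℕ → ℕ → ℕ
    Φ a b = ways s (off a b)
    x = fresh κ Φ (pred (ones σ w)) (twos σ w)
    y = fresh κ Φ (suc (ones σ w)) (pred (twos σ w))
    Good′ : Vec ℕ (suc (length s)) → Set
    Good′ q = Bounded (suc w) (toList (tail q)) × Fits σ q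
    attached : ∀ v → v ≤ w → ∀ {τ} → σ v ≡ τ → τ ≢ none → Counts (λ q → Good′ (v ∷ q)) (weigh τ x y)
    attached v v≤w {τ} refl τ≢ =
      counts-≡ (branch Φ σ v≤w eκ refl τ≢)
        (counts-⇔ (λ { q (bounded , fits) → bounded , fits-cons σ v q τ≢ fits })
                  (λ { q (bounded , fits) → bounded , proj₂ (fits-tail σ v q fits) })
          (counts-off s (suc w) (σ [ v ≔ next (σ v) ]) (agree-≔ s (next (σ v)) (m≤n⇒m≤1+n v≤w) agree) (m≤n⇒m≤1+n m≤w)))
    each : ∀ v → v ≤ w → Counts (λ q → Good′ (v ∷ q)) (weigh (σ v) x y)
    each v v≤w with σ v in e
    ... | none = counts-∅ (λ { q (_ , fits) → proj₁ (fits-tail σ v q fits) e })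
    ... | one  = attached v v≤w e (λ ())
    ... | even = attached v v≤w e (λ ())

  -- The end `u` is blanked out of the counts, since a child of `u` changes the state in another way
  -- than a child of any other vertex.
  counts-on : ∀ s w u σ → Agree w s σ → u ≤ w → u ≢ m →
              Counts {Vec ℕ (length s)} (GoodOn w u σ)
                     (ways s (on (σ u) (ones (σ [ u ≔ none ]) w) (twos (σ [ u ≔ none ]) w)))
  counts-on-step : ∀ κ s w u σ → Agree w (κ ∷ s) σ → u ≤ w → u ≢ m → κ ≢ none →
                   Counts {Vec ℕ (suc (length s))} (GoodOn w u σ)
                     (∂ (fresh κ (λ a b → ways s (on (σ u) a b))) (ones (σ [ u ≔ none ]) w) (twos (σ [ u ≔ none ]) w)
                      + attach (σ u) (λ a b → ways s (on κ a b)) (ones (σ [ u ≔ none ]) w) (twos (σ [ u ≔ none ]) w))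
  -- If the vertex m hangs from a vertex other than `u`, the final end is `u` or a label after m,
  -- never m itself. So `u` is the only possible parent.
  counts-on-end : ∀ s w u σ → Agree w (none ∷ s) σ → u ≤ w → u ≢ m →
                  Counts {Vec ℕ (suc (length s))} (GoodOn w u σ)
                    (attach (σ u) (λ a b → ways s (off a b)) (ones (σ [ u ≔ none ]) w) (twos (σ [ u ≔ none ]) w))

  counts-on []         w u σ agree u≤w u≢m = counts-∅ (λ { [] (_ , _ , e) → u≢m e })
  counts-on (none ∷ s) w u σ agree u≤w u≢m = counts-on-end s w u σ agree u≤w u≢m
  counts-on (one  ∷ s) w u σ agree u≤w u≢m = counts-on-step one  s w u σ agree u≤w u≢m (λ ())
  counts-on (even ∷ s) w u σ agree u≤w u≢m = counts-on-step even s w u σ agree u≤w u≢m (λ ())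

  counts-on-step κ s w u σ (eκ , _ , from , agree) u≤w u≢m κ≢ =
    -- Parents other than `u` give the derivation, and `u` gives `z`; as `ρ` has `none` at `u`, the
    -- first summand vanishes there.
    counts-≡ (trans (sumUpTo-+ w (λ v → weigh (ρ v) x y) (λ v → if v ≡ᵇ u then z else 0))
                    (cong₂ _+_ (sumUpTo-weigh ρ w x y) (sumUpTo-single w u z u≤w)))
      (counts-⇔ {P = λ q → head q ≤ w × Good′ q} (λ { (v ∷ q) (v≤w , bounded , rest) → (v≤w , bounded) , rest })
                (λ { (v ∷ q) ((v≤w , bounded) , rest) → v≤w , bounded , rest })
        (counts-∷ w (λ v → weigh (ρ v) x y + (if v ≡ᵇ u then z else 0)) each))
    where
    ρ = σ [ u ≔ none ]
    Φ : ℕ → ℕ → ℕ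
    Φ a b = ways s (on (σ u) a b)
    x = fresh κ Φ (pred (ones ρ w)) (twos ρ w)
    y = fresh κ Φ (suc (ones ρ w)) (pred (twos ρ w))
    z = attach (σ u) (λ a b → ways s (on κ a b)) (ones ρ w) (twos ρ w)
    Good′ : Vec ℕ (suc (length s)) → Set
    Good′ q = Bounded (suc w) (toList (tail q)) × Fits σ q × scan (toList q) w u ≡ m
    extended : ∀ {τ} → σ u ≡ τ → τ ≢ none →
               Counts (λ q → Good′ (u ∷ q)) (attach τ (λ a b → ways s (on κ a b)) (ones ρ w) (twos ρ w))
    extended {τ} refl τ≢ =
      counts-≡ count
        (counts-⇔ (λ { q (bounded , fits , e) → bounded , fits-cons σ u q τ≢ fits , trans (scan-hit (toList q) w u) e })
                  (λ { q (bounded , fits , e) → bounded , proj₂ (fits-tail σ u q fits) , trans (sym (scan-hit (toList q) w u)) e })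
          (counts-on s (suc w) (suc w) σ′ (agree-≔ s (next (σ u)) (m≤n⇒m≤1+n u≤w) agree) ≤-refl (λ e → κ≢ (from e))))
      where
      σ′ = σ [ u ≔ next (σ u) ]
      σ″ = σ′ [ suc w ≔ none ]
      below : ∀ v → v ≤ w → σ″ v ≡ σ′ v
      below v v≤w = ≔-other σ′ none (v≢1+w v≤w)
      ones″ : ones σ″ (suc w) ≡ ones σ′ w
      ones″ = trans (cong₂ (λ s τ → s + weigh τ 1 0) (ones-cong w below) (≔-same σ′ (suc w) none)) (+-identityʳ _)
      twos″ : twos σ″ (suc w) ≡ twos σ′ w
      twos″ = trans (cong₂ (λ s τ → s + weigh τ 0 1) (twos-cong w below) (≔-same σ′ (suc w) none)) (+-identityʳ _)
      count : ways s (on (σ′ (suc w)) (ones σ″ (suc w)) (twos σ″ (suc w))) ≡ attach (σ u) (λ a b → ways s (on κ a b)) (ones ρ w) (twos ρ w)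
      count = trans (cong₂ (λ κ (a , b) → ways s (on κ a b)) (trans (≔-other σ _ (λ e → v≢1+w u≤w (sym e))) eκ) (cong₂ _,_ ones″ twos″))
                    (attach-ones-twos (λ a b → ways s (on κ a b)) σ u≤w (σ u) τ≢)
    attached : ∀ v → v ≤ w → v ≢ u → ∀ {τ} → σ v ≡ τ → τ ≢ none → Counts (λ q → Good′ (v ∷ q)) (weigh τ x y)
    attached v v≤w v≢u {τ} refl τ≢ =
      counts-≡ count
        (counts-⇔ (λ { q (bounded , fits , e) → bounded , fits-cons σ v q τ≢ fits , trans (scan-miss (toList q) w v≢u) e })
                  (λ { q (bounded , fits , e) → bounded , proj₂ (fits-tail σ v q fits) , trans (sym (scan-miss (toList q) w v≢u)) e })
          (counts-on s (suc w) u σ′ (agree-≔ s (next (σ v)) (m≤n⇒m≤1+n v≤w) agree) (m≤n⇒m≤1+n u≤w) u≢m))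
      where
      σ′ = σ [ v ≔ next (σ v) ]
      swap : ∀ x → (σ′ [ u ≔ none ]) x ≡ (ρ [ v ≔ next (σ v) ]) x
      swap = ≔-swap σ (next (σ v)) none (λ e → v≢u (sym e))
      count : ways s (on (σ′ u) (ones (σ′ [ u ≔ none ]) (suc w)) (twos (σ′ [ u ≔ none ]) (suc w))) ≡ weigh (σ v) x y
      count = trans (cong₂ (λ τ (a , b) → ways s (on τ a b)) (≔-other σ _ (λ e → v≢u (sym e)))
                           (cong₂ _,_ (ones-cong (suc w) (λ x _ → swap x)) (twos-cong (suc w) (λ x _ → swap x))))
                    (branch Φ ρ v≤w (trans (≔-other σ none (λ e → v≢1+w u≤w (sym e))) eκ) (≔-other σ none v≢u) τ≢)
    extend : Counts (λ q → Good′ (u ∷ q)) z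
    extend with σ u in e
    ... | none = counts-∅ (λ { q (_ , fits , _) → proj₁ (fits-tail σ u q fits) e })
    ... | one  = extended e (λ ())
    ... | even = extended e (λ ())
    other : ∀ v → v ≤ w → v ≢ u → Counts (λ q → Good′ (v ∷ q)) (weigh (σ v) x y)
    other v v≤w v≢u with σ v in e
    ... | none = counts-∅ (λ { q (_ , fits , _) → proj₁ (fits-tail σ v q fits) e })
    ... | one  = attached v v≤w v≢u e (λ ())
    ... | even = attached v v≤w v≢u e (λ ())
    each : ∀ v → v ≤ w → Counts (λ q → Good′ (v ∷ q)) (weigh (ρ v) x y + (if v ≡ᵇ u then z else 0))
    each v v≤w with v ≟ u
    ... | yes refl = counts-≡ (sym (cong₂ (λ τ t → weigh τ x y + (if t then z else 0)) (≔-same σ v none) (≡ᵇ-refl v))) extend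
    ... | no v≢u   = counts-≡ (sym (trans (cong₂ (λ τ t → weigh τ x y + (if t then z else 0)) (≔-other σ none v≢u) (≡ᵇ-≢ v≢u)) (+-identityʳ _)))
                              (other v v≤w v≢u)

  counts-on-end s w u σ (eκ , to , _ , agree) u≤w u≢m =
    counts-≡ (sumUpTo-single w u z u≤w)
      (counts-⇔ {P = λ q → head q ≤ w × Good′ q} (λ { (v ∷ q) (v≤w , bounded , rest) → (v≤w , bounded) , rest })
                (λ { (v ∷ q) ((v≤w , bounded) , rest) → v≤w , bounded , rest })
        (counts-∷ w (λ v → if v ≡ᵇ u then z else 0) each))
    where
    ρ = σ [ u ≔ none ]
    z = attach (σ u) (λ a b → ways s (off a b)) (ones ρ w) (twos ρ w)
    Good′ : Vec ℕ (suc (length s)) → Set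
    Good′ q = Bounded (suc w) (toList (tail q)) × Fits σ q × scan (toList q) w u ≡ m
    ended : σ u ≢ none → Counts (λ q → Good′ (u ∷ q)) z
    ended τ≢ =
      counts-≡ (trans (fresh-ones-twos (λ a b → ways s (off a b)) σ′ w σ′m)
                      (attach-ones-twos (λ a b → ways s (off a b)) σ u≤w (σ u) τ≢))
        (counts-⇔ (λ { q (bounded , fits) → bounded , fits-cons σ u q τ≢ fits ,
                       trans (scan-hit (toList q) w u)
                         (trans (scan-childless q (suc w) (suc w) (subst (λ τ → Allowed τ (childCount q (suc w))) σ′m (fits (suc w)))) (to refl)) })
                  (λ { q (bounded , fits , e) → bounded , proj₂ (fits-tail σ u q fits) })
          (counts-off s (suc w) σ′ (agree-≔ s (next (σ u)) (m≤n⇒m≤1+n u≤w) agree) (≤-reflexive (sym (to refl)))))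
      where
      σ′ = σ [ u ≔ next (σ u) ]
      σ′m : σ′ (suc w) ≡ none
      σ′m = trans (≔-other σ _ (λ e → v≢1+w u≤w (sym e))) eκ
    missed : ∀ {r} → r ≡ u ⊎ suc w < r → r ≢ m
    missed (inj₁ refl) e    = u≢m e
    missed (inj₂ l)    refl = <⇒≢ l (to refl)
    extend : Counts (λ q → Good′ (u ∷ q)) z
    extend with σ u in e | ended
    ... | none | _ = counts-∅ (λ { q (_ , fits , _) → proj₁ (fits-tail σ u q fits) e })
    ... | one  | c = c (λ ())
    ... | even | c = c (λ ())
    each : ∀ v → v ≤ w → Counts (λ q → Good′ (v ∷ q)) (if v ≡ᵇ u then z else 0)
    each v v≤w with v ≟ u
    ... | yes refl = counts-≡ (sym (cong (λ t → if t then z else 0) (≡ᵇ-refl v))) extend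
    ... | no v≢u   = counts-≡ (sym (cong (λ t → if t then z else 0) (≡ᵇ-≢ v≢u)))
                       (counts-∅ (λ { q (_ , _ , e) → missed (scan-range (toList q) (suc w) u) (trans (sym (scan-miss (toList q) w v≢u)) e) }))

-- Agreement of `eoc` with the one-pass reading.

firstChild-skip : ∀ pre xs v c → All (_≢ v) pre → firstChild (pre ++ xs) v c ≡ firstChild xs v (length pre + c)
firstChild-skip []        xs v c []          = refl
firstChild-skip (x ∷ pre) xs v c (x≢v ∷ pre≢) =
  trans (cong (λ t → if t then just c else firstChild (pre ++ xs) v (suc c)) (≡ᵇ-≢ x≢v))
        (trans (firstChild-skip pre xs v (suc c) pre≢) (cong (firstChild xs v) (+-suc (length pre) c)))

firstChild-hit : ∀ xs v c → firstChild (v ∷ xs) v c ≡ just c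
firstChild-hit xs v c = cong (λ t → if t then just c else firstChild xs v (suc c)) (≡ᵇ-refl v)

chain-nothing : ∀ fuel ps v → firstChild ps v 2 ≡ nothing → chain fuel ps v ≡ v
chain-nothing zero       ps v e = refl
chain-nothing (suc fuel) ps v e rewrite e = refl

chain-just : ∀ fuel ps v c → firstChild ps v 2 ≡ just c → chain (suc fuel) ps v ≡ chain fuel ps c
chain-just fuel ps v c e rewrite e = refl

length-∷ʳ : ∀ pre (x : ℕ) → length (pre ++ [ x ]) ≡ suc (length pre)
length-∷ʳ pre x = trans (length-++ pre) (+-comm (length pre) 1)

-- `pre` holds the parents already read. None of them is `u`, so the search for the smallest child
-- of `u` can skip them; after a handover the new end exceeds every entry of `pre`. Each handover
-- uses up an entry of `xs`, so `length xs` bounds the fuel required.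
chain-scan : ∀ xs fuel pre u → length xs ≤ fuel → All (_≢ u) pre → All (_≤ suc (length pre)) pre →
             Bounded (suc (length pre)) xs → chain fuel (pre ++ xs) u ≡ scan xs (suc (length pre)) u
chain-scan [] fuel pre u _ pre≢ _ _ = chain-nothing fuel (pre ++ []) u (firstChild-skip pre [] u 2 pre≢)
chain-scan (x ∷ xs) (suc fuel) pre u (s≤s xs≤) pre≢ pre≤ (x≤ , bounded) with x ≟ u
... | yes refl = begin
  chain (suc fuel) (pre ++ x ∷ xs) x
    ≡⟨ chain-just fuel (pre ++ x ∷ xs) x (length pre + 2) (trans (firstChild-skip pre (x ∷ xs) x 2 pre≢) (firstChild-hit xs x _)) ⟩
  chain fuel (pre ++ x ∷ xs) (length pre + 2)
    ≡⟨ cong₂ (chain fuel) (sym (++-assoc pre [ x ] xs)) (+-comm (length pre) 2) ⟩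
  chain fuel ((pre ++ [ x ]) ++ xs) (2 + length pre)
    ≡⟨ chain-scan xs fuel (pre ++ [ x ]) (2 + length pre) xs≤ (All.map v≢1+w (∷ʳ⁺ pre≤ x≤)) 
         (All.map (λ v≤ → ≤-trans (m≤n⇒m≤1+n v≤) (≤-reflexive (cong suc (sym (length-∷ʳ pre x))))) (∷ʳ⁺ pre≤ x≤))
         (subst (λ w → Bounded (suc w) xs) (sym (length-∷ʳ pre x)) bounded) ⟩
  scan xs (suc (length (pre ++ [ x ]))) (2 + length pre)
    ≡⟨ cong (λ w → scan xs (suc w) (2 + length pre)) (length-∷ʳ pre x) ⟩
  scan xs (2 + length pre) (2 + length pre)
    ≡⟨ scan-hit xs (suc (length pre)) x ⟨
  scan (x ∷ xs) (suc (length pre)) x ∎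
... | no x≢u = begin
  chain (suc fuel) (pre ++ x ∷ xs) u
    ≡⟨ cong (λ ps → chain (suc fuel) ps u) (sym (++-assoc pre [ x ] xs)) ⟩
  chain (suc fuel) ((pre ++ [ x ]) ++ xs) u
    ≡⟨ chain-scan xs (suc fuel) (pre ++ [ x ]) u (m≤n⇒m≤1+n xs≤) (∷ʳ⁺ pre≢ x≢u) 
         (All.map (λ v≤ → ≤-trans (m≤n⇒m≤1+n v≤) (≤-reflexive (cong suc (sym (length-∷ʳ pre x))))) (∷ʳ⁺ pre≤ x≤))
         (subst (λ w → Bounded (suc w) xs) (sym (length-∷ʳ pre x)) bounded) ⟩
  scan xs (suc (length (pre ++ [ x ]))) u
    ≡⟨ cong (λ w → scan xs (suc w) u) (length-∷ʳ pre x) ⟩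
  scan xs (2 + length pre) u
    ≡⟨ scan-miss xs (suc (length pre)) x≢u ⟨
  scan (x ∷ xs) (suc (length pre)) u ∎

eoc-scan : ∀ {L} (p : Vec ℕ L) → Bounded 1 (toList p) → eoc p ≡ scan (toList p) 1 1
eoc-scan {L} p bounded = chain-scan (toList p) (suc L) [] 1 (≤-trans (≤-reflexive (length-toList p)) (n≤1+n L)) [] [] bounded

-- Trees as parent vectors with the last vertex split off.

bounded-lookup : ∀ {L} (p : Vec ℕ L) w → (∀ i → lookup p i ≤ w + toℕ i) → Bounded w (toList p)
bounded-lookup []      w _ = tt
bounded-lookup (x ∷ p) w l =
  subst (x ≤_) (+-identityʳ w) (l zero) , bounded-lookup p (suc w) (λ i → subst (lookup p i ≤_) (+-suc w (toℕ i)) (l (suc i)))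

lookup-bounded : ∀ {L} (p : Vec ℕ L) w → Bounded w (toList p) → ∀ i → lookup p i ≤ w + toℕ i
lookup-bounded (x ∷ p) w (x≤ , _)       zero    = subst (x ≤_) (sym (+-identityʳ w)) x≤
lookup-bounded (x ∷ p) w (_  , bounded) (suc i) = subst (lookup p i ≤_) (sym (+-suc w (toℕ i))) (lookup-bounded p (suc w) bounded i)

bounded-init : ∀ {L} (q : Vec ℕ L) y w → Bounded w (toList (q ∷ʳ y)) → Bounded w (toList q)
bounded-init []      y w _                = tt
bounded-init (x ∷ q) y w (x≤ , bounded) = x≤ , bounded-init q y (suc w) bounded

bounded-∷ʳ : ∀ {L} (q : Vec ℕ L) y w → Bounded w (toList q) → y ≤ w + L → Bounded w (toList (q ∷ʳ y))
bounded-∷ʳ         []      y w _              y≤ = subst (y ≤_) (+-identityʳ w) y≤ , tt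
bounded-∷ʳ {suc L} (x ∷ q) y w (x≤ , bounded) y≤ = x≤ , bounded-∷ʳ q y (suc w) bounded (subst (y ≤_) (+-suc w L) y≤)

nth-last : ∀ {L} (q : Vec ℕ L) y → nth (toList (q ∷ʳ y)) L ≡ y
nth-last []      y = refl
nth-last (x ∷ q) y = nth-last q y

childCount-∷ʳ-hit : ∀ {L} (q : Vec ℕ L) v → childCount (q ∷ʳ v) v ≡ suc (childCount q v)
childCount-∷ʳ-hit []      v = childCount-hit v []
childCount-∷ʳ-hit (x ∷ q) v with x ≟ v
... | yes refl = trans (childCount-hit x (q ∷ʳ x)) (cong suc (trans (childCount-∷ʳ-hit q x) (sym (childCount-hit x q))))
... | no x≢v   = trans (childCount-miss (q ∷ʳ v) x≢v) (trans (childCount-∷ʳ-hit q v) (cong suc (sym (childCount-miss q x≢v))))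

childCount-∷ʳ-miss : ∀ {L} (q : Vec ℕ L) {y v} → y ≢ v → childCount (q ∷ʳ y) v ≡ childCount q v
childCount-∷ʳ-miss []      y≢v = childCount-miss [] y≢v
childCount-∷ʳ-miss (x ∷ q) {y} {v} y≢v with x ≟ v
... | yes refl = trans (childCount-hit x (q ∷ʳ y)) (trans (cong suc (childCount-∷ʳ-miss q y≢v)) (sym (childCount-hit x q)))
... | no x≢v   = trans (childCount-miss (q ∷ʳ y) x≢v) (trans (childCount-∷ʳ-miss q y≢v) (sym (childCount-miss q x≢v)))

childCount≡0 : ∀ {L} (p : Vec ℕ L) v → (∀ i → lookup p i ≢ v) → childCount p v ≡ 0
childCount≡0 []      v _  = refl
childCount≡0 (x ∷ p) v ≢v = trans (childCount-miss p (≢v zero)) (childCount≡0 p v (λ i → ≢v (suc i)))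

lookup≢ : ∀ {L} (p : Vec ℕ L) v → childCount p v ≡ 0 → ∀ i → lookup p i ≢ v
lookup≢ (x ∷ p) v e zero    refl with () ← trans (sym (childCount-hit v p)) e
lookup≢ (x ∷ p) v e (suc i) l with x ≟ v
... | yes refl with () ← trans (sym (childCount-hit v p)) e
... | no x≢v = lookup≢ p v (trans (sym (childCount-miss p x≢v)) e) i l

scan-∷ʳ : ∀ {L} (q : Vec ℕ L) y w u → scan (toList (q ∷ʳ y)) w u ≡ scan (y ∷ []) (w + L) (scan (toList q) w u)
scan-∷ʳ         []      y w u = cong (λ w → scan (y ∷ []) w u) (sym (+-identityʳ w))
scan-∷ʳ {suc L} (x ∷ q) y w u with x ≡ᵇ u
... | true  = trans (scan-∷ʳ q y (suc w) (suc w)) (cong (λ w′ → scan (y ∷ []) w′ (scan (toList q) (suc w) (suc w))) (sym (+-suc w L)))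
... | false = trans (scan-∷ʳ q y (suc w) u) (cong (λ w′ → scan (y ∷ []) w′ (scan (toList q) (suc w) u)) (sym (+-suc w L)))

-- Label 0 gets `none`, which expresses that all parents are positive.
demand : ℕ → ℕ → ℕ → Demand
demand m k = (λ _ → even) [ k ≔ one ] [ m ≔ none ] [ 0 ≔ none ]

demand-m : ∀ m k → m ≢ 0 → demand m k m ≡ none
demand-m m k m≢0 = trans (≔-other ((λ _ → even) [ k ≔ one ] [ m ≔ none ]) none m≢0) (≔-same ((λ _ → even) [ k ≔ one ]) m none)

demand-k : ∀ m k → k ≢ 0 → m ≢ k → demand m k k ≡ one
demand-k m k k≢0 m≢k = trans (≔-other ((λ _ → even) [ k ≔ one ] [ m ≔ none ]) none k≢0)
  (trans (≔-other ((λ _ → even) [ k ≔ one ]) none (λ e → m≢k (sym e))) (≔-same (λ _ → even) k one))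

demand-even : ∀ m k {v} → v ≢ 0 → v ≢ m → v ≢ k → demand m k v ≡ even
demand-even m k v≢0 v≢m v≢k = trans (≔-other ((λ _ → even) [ k ≔ one ] [ m ≔ none ]) none v≢0)
  (trans (≔-other ((λ _ → even) [ k ≔ one ]) none v≢m) (≔-other (λ _ → even) one v≢k))

module _ {L m k : ℕ} (k≢0 : k ≢ 0) (m≢0 : m ≢ 0) (m≢k : m ≢ k) (m≤ : m ≤ suc L) (k≤ : k ≤ suc L) where

  Tree : Vec ℕ (suc L) → Set
  Tree p = IsSOBT p × eoc p ≡ m × pom p ≡ k

  -- The last entry is the parent of 2n+1. This child of k is no longer in `q`, which is why k keeps
  -- the demand `one` there.
  Reduced : Vec ℕ (suc L) → Set
  Reduced p = ∃ λ (q : Vec ℕ L) → GoodOn m 1 1 (demand m k) q × p ≡ q ∷ʳ k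

  tree⇒reduced : ∀ p → Tree p → Reduced p
  tree⇒reduced p (tree , eoc≡ , pom≡) with initLast p
  ... | q , y , refl with trans (sym (nth-last q y)) pom≡
  ...   | refl = q , (bounded-init q k 1 bounded , fits , scan≡) , refl
    where
    open IsSOBT tree
    bounded : Bounded 1 (toList (q ∷ʳ k))
    bounded = bounded-lookup (q ∷ʳ k) 1 (λ i → ≤-pred (subst (lookup (q ∷ʳ k) i <_) (+-comm (toℕ i) 2) (parent-lt i)))
    last-step : scan (k ∷ []) (1 + L) (scan (toList q) 1 1) ≡ m
    last-step = trans (sym (scan-∷ʳ q k 1 1)) (trans (sym (eoc-scan (q ∷ʳ k) bounded)) eoc≡)
    unextended : ∀ r → scan (k ∷ []) (1 + L) r ≡ m → r ≡ m
    unextended r e with k ≟ r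
    -- If the last vertex hung from the end of the chain, it would itself be the end `2 + L`, beyond
    -- the bound on m.
    ... | yes refl = ⊥-elim (1+n≰n (≤-trans (≤-reflexive (trans (sym (scan-hit [] (1 + L) k)) e)) m≤))
    ... | no k≢r   = trans (sym (scan-miss [] (1 + L) k≢r)) e
    scan≡ : scan (toList q) 1 1 ≡ m
    scan≡ = unextended _ last-step
    fits : Fits (demand m k) q
    fits v with v ≟ 0
    ... | yes refl = trans (sym (childCount-∷ʳ-miss q k≢0)) (childCount≡0 (q ∷ʳ k) 0 (λ i e → 1+n≰n (subst (1 ≤_) e (parent-pos i))))
    ... | no v≢0 with v ≟ m
    ...   | yes refl = subst (λ τ → Allowed τ (childCount q v)) (sym (demand-m m k m≢0))
                         (trans (cong (childCount q) (sym scan≡)) (childCount-scan q 1 1 (bounded-init q k 1 bounded)))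
    ...   | no v≢m with v ≟ k
    ...     | yes refl = subst (λ τ → Allowed τ (childCount q v)) (sym (demand-k m k k≢0 m≢k))
                           (once (subst (λ c → c ≡ 0 ⊎ c ≡ 2) (childCount-∷ʳ-hit q v) (binary v (n≢0⇒n>0 v≢0) (m≤n⇒m≤1+n k≤))))
      where
      once : ∀ {c} → suc c ≡ 0 ⊎ suc c ≡ 2 → c ≡ 1
      once (inj₂ refl) = refl
    ...     | no v≢k = subst₂ Allowed (sym (demand-even m k v≢0 v≢m v≢k)) (childCount-∷ʳ-miss q (λ e → v≢k (sym e))) (children (v ≤? 2 + L))
      where
      children : _ → childCount (q ∷ʳ k) v ≡ 0 ⊎ childCount (q ∷ʳ k) v ≡ 2
      children (yes v≤) = binary v (n≢0⇒n>0 v≢0) v≤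
      children (no v≰)  = inj₁ (childCount≡0 (q ∷ʳ k) v (λ i e → v≰ (subst (_≤ 2 + L) e
        (≤-trans (<⇒≤ (parent-lt i)) (≤-trans (≤-reflexive (+-comm (toℕ i) 2)) (s≤s (toℕ<n i)))))))

  reduced⇒tree : ∀ p → Reduced p → Tree p
  reduced⇒tree p (q , (bounded , fits , scan≡) , refl) = record
    { parent-pos = λ i → n≢0⇒n>0 (lookup≢ (q ∷ʳ k) 0 (trans (childCount-∷ʳ-miss q k≢0) (fits 0)) i)
    ; parent-lt  = λ i → subst (lookup (q ∷ʳ k) i <_) (+-comm 2 (toℕ i)) (s≤s (lookup-bounded (q ∷ʳ k) 1 bounded′ i))
    ; binary     = λ v 1≤v _ → binary v (λ { refl → 1+n≰n 1≤v })
    } , trans (eoc-scan (q ∷ʳ k) bounded′) (trans (scan-∷ʳ q k 1 1) (trans (cong (scan (k ∷ []) (1 + L)) scan≡)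
          (scan-miss [] (1 + L) (λ e → m≢k (sym e))))) , nth-last q k
    where
    bounded′ : Bounded 1 (toList (q ∷ʳ k))
    bounded′ = bounded-∷ʳ q k 1 bounded k≤
    binary : ∀ v → v ≢ 0 → childCount (q ∷ʳ k) v ≡ 0 ⊎ childCount (q ∷ʳ k) v ≡ 2
    binary v v≢0 with v ≟ k
    ... | yes refl = inj₂ (trans (childCount-∷ʳ-hit q v) (cong suc (subst (λ τ → Allowed τ (childCount q v)) (demand-k m k k≢0 m≢k) (fits v))))
    ... | no v≢k with v ≟ m
    ...   | yes refl = inj₁ (trans (childCount-∷ʳ-miss q (λ e → v≢k (sym e))) (subst (λ τ → Allowed τ (childCount q v)) (demand-m m k m≢0) (fits v)))
    ...   | no v≢m = subst₂ Allowed (demand-even m k v≢0 v≢m v≢k) (sym (childCount-∷ʳ-miss q (λ e → v≢k (sym e)))) (fits v)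

-- The end of the chain is a leaf, while `pom` has the last vertex as a child.
eoc≢pom : ∀ {L} (p : Vec ℕ (suc L)) → IsSOBT p → eoc p ≢ pom p
eoc≢pom p tree e with initLast p
... | q , y , refl =
  1+n≢0 (trans (sym (childCount-∷ʳ-hit q y))
    (trans (cong (childCount (q ∷ʳ y)) (trans (sym (nth-last q y)) (trans (sym e) (eoc-scan (q ∷ʳ y) bounded))))
           (childCount-scan (q ∷ʳ y) 1 1 bounded)))
  where
  open IsSOBT tree
  bounded : Bounded 1 (toList (q ∷ʳ y))
  bounded = bounded-lookup (q ∷ʳ y) 1 (λ i → ≤-pred (subst (lookup (q ∷ʳ y) i <_) (+-comm (toℕ i) 2) (parent-lt i)))

-- Schedules agree with the demands of m and k; conclusion.

module _ {m : ℕ} {σ : ℕ → Demand} where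

  agree-evens : ∀ N w → m ≤ w → (∀ v → w < v → σ v ≡ even) → Agree m w (evens N) σ
  agree-evens zero    w m≤w e = e
  agree-evens (suc N) w m≤w e =
    e (suc w) ≤-refl , (λ ()) , (λ { refl → ⊥-elim (1+n≰n m≤w) }) , agree-evens N (suc w) (m≤n⇒m≤1+n m≤w) (λ v w<v → e v (<⇒≤ w<v))

  agree-setNone : ∀ N w i → m ≡ suc w + i → i < N → σ m ≡ none → (∀ v → w < v → v ≢ m → σ v ≡ even) →
                  Agree m w (setNone i (evens N)) σ
  agree-setNone (suc N) w zero    refl _ σm e =
    subst (λ v → σ v ≡ none) (cong suc (+-identityʳ w)) σm , (λ _ → sym (cong suc (+-identityʳ w))) , (λ _ → refl) ,
    agree-evens N (suc w) (≤-reflexive (cong suc (+-identityʳ w))) (λ v w<v → e v (<⇒≤ w<v) (λ { refl → <-irrefl (sym (cong suc (+-identityʳ w))) w<v }))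
  agree-setNone (suc N) w (suc i) refl (s≤s i<N) σm e =
    e (suc w) ≤-refl 1+w≢ , (λ ()) , (λ e → ⊥-elim (1+w≢ e)) ,
    agree-setNone N (suc w) i (cong suc (+-suc w i)) i<N σm (λ v w<v → e v (<⇒≤ w<v))
    where
    1+w≢ : suc w ≢ suc w + suc i
    1+w≢ e = m≢1+m+n (suc w) (trans e (+-suc (suc w) i))

  agree-setOne : ∀ N w i {k} → k ≡ suc w + i → i < N → m ≤ w → σ k ≡ one → (∀ v → w < v → v ≢ k → σ v ≡ even) →
                 Agree m w (setOne i (evens N)) σ
  agree-setOne (suc N) w zero    refl _ m≤w σk e =
    subst (λ v → σ v ≡ one) (cong suc (+-identityʳ w)) σk , (λ ()) , (λ { refl → ⊥-elim (1+n≰n m≤w) }) ,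
    agree-evens N (suc w) (m≤n⇒m≤1+n m≤w) (λ v w<v → e v (<⇒≤ w<v) (λ { refl → <-irrefl (sym (cong suc (+-identityʳ w))) w<v }))
  agree-setOne (suc N) w (suc i) refl (s≤s i<N) m≤w σk e =
    e (suc w) ≤-refl (λ e → m≢1+m+n (suc w) (trans e (+-suc (suc w) i))) , (λ ()) , (λ { refl → ⊥-elim (1+n≰n m≤w) }) ,
    agree-setOne N (suc w) i (cong suc (+-suc w i)) i<N (m≤n⇒m≤1+n m≤w) σk (λ v w<v → e v (<⇒≤ w<v))

  agree-schedule : ∀ N w i l {k} → m ≡ suc w + i → k ≡ suc w + l → i < N → l < N → i ≢ l → σ m ≡ none → σ k ≡ one →
                   (∀ v → w < v → v ≢ m → v ≢ k → σ v ≡ even) → Agree m w (schedule N i l) σ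
  agree-schedule (suc N) w zero zero refl refl _ _ i≢l = ⊥-elim (i≢l refl)
  agree-schedule (suc N) w zero (suc l) refl refl _ (s≤s l<N) _ σm σk e =
    subst (λ v → σ v ≡ none) (cong suc (+-identityʳ w)) σm , (λ _ → sym (cong suc (+-identityʳ w))) , (λ _ → refl) ,
    agree-setOne N (suc w) l (cong suc (+-suc w l)) l<N (≤-reflexive (cong suc (+-identityʳ w))) σk
      (λ v w<v → e v (<⇒≤ w<v) (λ { refl → <-irrefl (sym (cong suc (+-identityʳ w))) w<v }))
  agree-schedule (suc N) w (suc i) zero refl refl (s≤s i<N) _ _ σm σk e =
    subst (λ v → σ v ≡ one) (cong suc (+-identityʳ w)) σk , (λ ()) , (λ e → ⊥-elim (m≢1+m+n (suc w) (trans e (+-suc (suc w) i)))) ,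
    agree-setNone N (suc w) i (cong suc (+-suc w i)) i<N σm
      (λ v w<v v≢m → e v (<⇒≤ w<v) v≢m (λ { refl → <-irrefl (sym (cong suc (+-identityʳ w))) w<v }))
  agree-schedule (suc N) w (suc i) (suc l) refl refl (s≤s i<N) (s≤s l<N) i≢l σm σk e =
    e (suc w) ≤-refl (λ e → m≢1+m+n (suc w) (trans e (+-suc (suc w) i))) (λ e → m≢1+m+n (suc w) (trans e (+-suc (suc w) l))) ,
    (λ ()) , (λ e → ⊥-elim (m≢1+m+n (suc w) (trans e (+-suc (suc w) i)))) ,
    agree-schedule N (suc w) i l (cong suc (+-suc w i)) (cong suc (+-suc w l)) i<N l<N (λ e → i≢l (cong suc e)) σm σk (λ v w<v → e v (<⇒≤ w<v))

length-setOne : ∀ l s → length (setOne l s) ≡ length s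
length-setOne l       []      = refl
length-setOne zero    (κ ∷ s) = refl
length-setOne (suc l) (κ ∷ s) = cong suc (length-setOne l s)

length-setNone : ∀ l s → length (setNone l s) ≡ length s
length-setNone l       []         = refl
length-setNone zero    (none ∷ s) = refl
length-setNone zero    (one  ∷ s) = refl
length-setNone zero    (even ∷ s) = refl
length-setNone (suc l) (κ    ∷ s) = cong suc (length-setNone l s)

resize : ∀ {i L c} {P : ∀ {j} → Vec ℕ j → Set} → i ≡ L → Counts {Vec ℕ i} P c → Counts {Vec ℕ L} P c
resize refl counts = counts

-- The schedule begins with vertex 1, for which the vectors hold no parent. Its step from `root` is
-- forced and evaluates by computation: to a state `off` if vertex 1 ends the chain, otherwise to a
-- state `on` with end 1.
counts-schedule : ∀ L m k → m ≤ L → k ≤ L → m ≢ k →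
                  Counts {Vec ℕ L} (GoodOn (suc m) 1 1 (demand (suc m) (suc k))) (ways (schedule (suc L) m k) root)
counts-schedule L zero zero _ _ m≢k = ⊥-elim (m≢k refl)
counts-schedule L zero (suc k) _ k< m≢k =
  counts-⇔ (λ { q (bounded , fits) → bounded , fits , scan-childless q 1 1 (fits 1) })
           (λ { q (bounded , fits , _) → bounded , fits })
    (resize {P = GoodOff 1 σ} (trans (length-setOne k (evens L)) (length-replicate L))
      (counts-off 1 (setOne k (evens L)) 1 σ
        (agree-setOne L 1 k refl k< ≤-refl (demand-k 1 (2 + k) (λ ()) (λ ()))
          (λ { v 1<v v≢k → demand-even 1 (2 + k) (λ { refl → n≮0 1<v }) (λ { refl → <-irrefl refl 1<v }) v≢k }))
        ≤-refl))
  where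
  σ = demand 1 (2 + k)
counts-schedule L (suc m) zero m< _ m≢k =
  (resize {P = GoodOn (2 + m) 1 1 σ} (trans (length-setNone m (evens L)) (length-replicate L))
      (counts-on (2 + m) (setNone m (evens L)) 1 1 σ
        (agree-setNone L 1 m refl m< (demand-m (2 + m) 1 (λ ()))
          (λ { v 1<v v≢m → demand-even (2 + m) 1 (λ { refl → n≮0 1<v }) v≢m (λ { refl → <-irrefl refl 1<v }) }))
        ≤-refl (λ ())))
  where
  σ = demand (2 + m) 1
counts-schedule L (suc m) (suc k) m< k< m≢k =
    (resize {P = GoodOn (2 + m) 1 1 σ} (trans (length-setOne k (setNone m (evens L))) (trans (length-setNone m (evens L)) (length-replicate L)))
      (counts-on (2 + m) (schedule L m k) 1 1 σ
        (agree-schedule L 1 m k refl refl m< k< (λ e → m≢k (cong suc e)) (demand-m (2 + m) (2 + k) (λ ())) (demand-k (2 + m) (2 + k) (λ ()) m≢k′)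
          (λ { v 1<v v≢m v≢k → demand-even (2 + m) (2 + k) (λ { refl → n≮0 1<v }) v≢m v≢k }))
        ≤-refl (λ ())))
  where
  σ = demand (2 + m) (2 + k)
  m≢k′ : 2 + m ≢ 2 + k
  m≢k′ e = m≢k (suc-injective e)

theorem1p1 : (f : ℕ → ℕ → ℕ → ℕ) → IsDeltaSequence f →
    ∀ n m k → 1 ≤ n → 1 ≤ m → m ≤ 2 * n → 1 ≤ k → k ≤ 2 * n →
    CountIs n m k (f n m k)
theorem1p1 f Δ (suc n) (suc m) (suc k) _ _ m≤ _ k≤ with m ≟ k
-- No tree lies on the diagonal, and there `setOne` prevents any `none` in the schedule, so its
-- count is 0 as well.
... | yes refl = [] , ([] , (λ _ ()) , (λ p tree e e′ → ⊥-elim (eoc≢pom p tree (trans e (sym e′))))) ,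
  sym (trans (delta-ways f Δ n m m m≤ m≤) (ways-endless (schedule-diagonal (2 * suc n) m) one 0 0))
... | no m≢k =
  let ts , unique , sound , complete , size =
        counts-⇔ (reduced⇒tree (λ ()) (λ ()) m≢k′ m≤ k≤) (tree⇒reduced (λ ()) (λ ()) m≢k′ m≤ k≤)
          (counts-map (_∷ʳ suc k) (λ {q} {q′} → ∷ʳ-injectiveˡ q q′)
            -- `n + suc (n + 0)` is the predecessor of `2 * suc n` as it computes.
            (counts-schedule (n + suc (n + 0)) m k (≤-pred m≤) (≤-pred k≤) m≢k))
  in ts , (unique , sound , (λ p tree e e′ → complete p (tree , e , e′))) , trans size (sym (delta-ways f Δ n m k m≤ k≤))
  where
  m≢k′ : suc m ≢ suc k
  m≢k′ e = m≢k (suc-injective e)
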